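{- Let $R$ be a finite local Frobenius ring which is not a field, with fixed primitive additive character $\psi$, and let $\tau$ be a non-primitive multiplicative character of $R$. Then: (i) $K_\tau(a)=0$ for every $a\in R\setminus R^\times$; (ii) if $R$ has odd characteristic, then moreover $K_\tau(a)=0$ for every $a\in R$ with $a\notin (R^\times)^2$ (the set of squares of units).
   Context: All rings are finite and commutative with identity; $R^\times$ is the unit group; $M$ is the maximal ideal of the local ring $R$. An additive character $(R,+)\to\mathbb{C}^*$ is primitive if the only ideal on which it is identically $1$ is $(0)$; $R$ is Frobenius if such a character exists. A multiplicative character is a homomorphism $R^\times\to\mathbb{C}^*$. Its conductor is: $R$ if the character is trivial; otherwise the largest ideal $I\subseteq M$ such that the character is identically $1$ on the subgroup $1+I$. A multiplicative character is primitive if its conductor is $(0)$. The twisted Kloosterman sum is $K_\tau(a)=\sum_{u\in R^\times}\tau(u)\psi(u+au^{ -1})$. "Odd characteristic" for a local ring means the residue field $R/M$ has odd characteristic. -}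

module Defs where

open import Algebra.Bundles using (CommutativeRing; AbelianGroup)
open import Algebra.Definitions using (Invertible)
open import Algebra.Morphism.Structures using (module GroupMorphisms)
open import Algebra.Structures using (IsAbelianGroup; IsCommutativeRing)
import Algebra.Consequences.Setoid as Consequences
import Algebra.Definitions.RawMonoid as RawMonoidDefs
import Algebra.Properties.Ring as RingProperties
import Data.Fin.Properties as Fin
open import Data.Nat.Base as ℕ using (ℕ)
open import Data.Nat.Divisibility using (_∣_)
import Data.Nat.Properties as ℕ
open import Data.Product.Base using (Σ; ∃-syntax; _×_; _,_; proj₁; proj₂)
open import Data.Rational.Base as ℚ using (ℚ; 0ℚ; 1ℚ; ½; ∣_∣)
import Data.Rational.Properties as ℚ
open import Data.Rational.Solver using (module +-*-Solver)
open import Data.Sum.Base using (_⊎_)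
open import Function.Bundles using (Inverse; _⇔_)
import Function.Properties.Inverse as InverseProperties
open import Level using (Level; 0ℓ; _⊔_; suc)
open import Relation.Binary.Bundles using (Setoid)
open import Relation.Binary.Definitions using (Decidable)
open import Relation.Binary.PropositionalEquality
  using (_≡_; refl; sym; trans; cong; subst; subst₂)
import Relation.Binary.Reasoning.Setoid as ≈-Reasoning
open import Relation.Nullary using (¬_; Dec; yes; no)
import Relation.Nullary.Decidable as Dec
open import Relation.Unary using (Pred)

private
  variable
    c ℓ p q : Level

-- Cauchy sequences of rationals, identified (by _≈ℝ_) when their difference
-- tends to 0.
record ℝ : Set where
  no-eta-equality
  field
    seq    : ℕ → ℚ
    cauchy : ∀ ε → 0ℚ ℚ.< ε →
             ∃[ N ] (∀ m n → N ℕ.≤ m → N ℕ.≤ n → ∣ seq m ℚ.- seq n ∣ ℚ.< ε)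

open ℝ using (seq; cauchy)

infix 4 _≈ℝ_

record _≈ℝ_ (x y : ℝ) : Set where
  constructor vanishing
  field
    close : ∀ ε → 0ℚ ℚ.< ε → ∃[ N ] (∀ n → N ℕ.≤ n → ∣ seq x n ℚ.- seq y n ∣ ℚ.< ε)

open _≈ℝ_ using (close)

module Estimates where
  open +-*-Solver

  sub-self : ∀ {p q} → p ≡ q → p ℚ.- q ≡ 0ℚ
  sub-self {p} refl = ℚ.+-inverseʳ p

  ∣p-q∣≡∣q-p∣ : ∀ p q → ∣ p ℚ.- q ∣ ≡ ∣ q ℚ.- p ∣
  ∣p-q∣≡∣q-p∣ p q = trans (cong ∣_∣ (solve 2 (λ p q → p :- q := :- (q :- p)) refl p q))
                          (ℚ.∣-p∣≡∣p∣ (q ℚ.- p))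

  sub-+ : ∀ a b c d → (a ℚ.- b) ℚ.+ (c ℚ.- d) ≡ (a ℚ.+ c) ℚ.- (b ℚ.+ d)
  sub-+ = solve 4 (λ a b c d → (a :- b) :+ (c :- d) := (a :+ c) :- (b :+ d)) refl

  sub-neg : ∀ a b → b ℚ.- a ≡ (ℚ.- a) ℚ.- (ℚ.- b)
  sub-neg = solve 2 (λ a b → b :- a := :- a :- :- b) refl

  half-pos : ∀ {ε} → 0ℚ ℚ.< ε → 0ℚ ℚ.< ½ ℚ.* ε
  half-pos {ε} 0<ε =
    ℚ.positive⁻¹ (½ ℚ.* ε) {{ℚ.pos*pos⇒pos ½ ε {{ℚ.positive 0<ε}}}}

  halves : ∀ ε → ½ ℚ.* ε ℚ.+ ½ ℚ.* ε ≡ ε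
  halves ε = trans (sym (ℚ.*-distribʳ-+ ε ½ ½)) (ℚ.*-identityˡ ε)

  sum-small : ∀ {ε} p q → ∣ p ∣ ℚ.< ½ ℚ.* ε → ∣ q ∣ ℚ.< ½ ℚ.* ε → ∣ p ℚ.+ q ∣ ℚ.< ε
  sum-small {ε} p q p< q< =
    ℚ.≤-<-trans (ℚ.∣p+q∣≤∣p∣+∣q∣ p q) (subst (_ ℚ.<_) (halves ε) (ℚ.+-mono-< p< q<))

  module _ {ε B C : ℚ} (0<ε : 0ℚ ℚ.< ε) (0<B : 0ℚ ℚ.< B) (0<C : 0ℚ ℚ.< C) where

    0<B+C : 0ℚ ℚ.< B ℚ.+ C
    0<B+C = ℚ.+-mono-< 0<B 0<C

    private instance
      B+C-pos : ℚ.Positive (B ℚ.+ C)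
      B+C-pos = ℚ.positive 0<B+C

      B+C-nonZero : ℚ.NonZero (B ℚ.+ C)
      B+C-nonZero = ℚ.pos⇒nonZero (B ℚ.+ C)

    δ : ℚ
    δ = (ℚ.1/ (B ℚ.+ C)) ℚ.* ε

    0<δ : 0ℚ ℚ.< δ
    0<δ = ℚ.positive⁻¹ δ
      {{ℚ.pos*pos⇒pos (ℚ.1/ (B ℚ.+ C)) {{ℚ.1/pos⇒pos (B ℚ.+ C)}} ε {{ℚ.positive 0<ε}}}}

    Bδ+Cδ≡ε : B ℚ.* δ ℚ.+ C ℚ.* δ ≡ ε
    Bδ+Cδ≡ε = trans (sym (ℚ.*-distribʳ-+ δ B C))
      (trans (sym (ℚ.*-assoc (B ℚ.+ C) (ℚ.1/ (B ℚ.+ C)) ε))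
      (trans (cong (ℚ._* ε) (ℚ.*-inverseʳ (B ℚ.+ C))) (ℚ.*-identityˡ ε)))

    ∣p*q∣<B*δ : ∀ {D} p q → 0ℚ ℚ.< D → ∣ p ∣ ℚ.< D → ∣ q ∣ ℚ.< δ → ∣ p ℚ.* q ∣ ℚ.< D ℚ.* δ
    ∣p*q∣<B*δ {D} p q 0<D p< q< = subst (ℚ._< D ℚ.* δ) (sym (ℚ.∣p*q∣≡∣p∣*∣q∣ p q))
      (ℚ.≤-<-trans
        (ℚ.*-monoʳ-≤-nonNeg ∣ q ∣ {{ℚ.∣-∣-nonNeg q}} (ℚ.<⇒≤ p<))
        (ℚ.*-monoʳ-<-pos D {{ℚ.positive 0<D}} q<))

    product-close : ∀ x y x′ y′ → ∣ x ∣ ℚ.< B → ∣ y′ ∣ ℚ.< C →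
                    ∣ x ℚ.- x′ ∣ ℚ.< δ → ∣ y ℚ.- y′ ∣ ℚ.< δ →
                    ∣ x ℚ.* y ℚ.- x′ ℚ.* y′ ∣ ℚ.< ε
    product-close x y x′ y′ x< y′< x≈ y≈ =
      subst₂ ℚ._<_
        (cong ∣_∣ (solve 4 (λ x y x′ y′ → x :* (y :- y′) :+ y′ :* (x :- x′) := x :* y :- x′ :* y′)
                     refl x y x′ y′))
        Bδ+Cδ≡ε
        (ℚ.≤-<-trans (ℚ.∣p+q∣≤∣p∣+∣q∣ (x ℚ.* (y ℚ.- y′)) (y′ ℚ.* (x ℚ.- x′)))
          (ℚ.+-mono-< (∣p*q∣<B*δ x (y ℚ.- y′) 0<B x< y≈) (∣p*q∣<B*δ y′ (x ℚ.- x′) 0<C y′< x≈)))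

  bound : ∀ x → ∃[ B ] 0ℚ ℚ.< B × ∃[ N ] (∀ n → N ℕ.≤ n → ∣ seq x n ∣ ℚ.< B)
  bound x with N , close ← cauchy x 1ℚ (ℚ.positive⁻¹ 1ℚ) =
    1ℚ ℚ.+ ∣ seq x N ∣ ,
    ℚ.+-mono-<-≤ (ℚ.positive⁻¹ 1ℚ) (ℚ.0≤∣p∣ (seq x N)) ,
    N , λ n N≤n → ℚ.≤-<-trans
      (subst (λ q → ∣ q ∣ ℚ.≤ ∣ seq x n ℚ.- seq x N ∣ ℚ.+ ∣ seq x N ∣)
        (solve 2 (λ p q → (p :- q) :+ q := p) refl (seq x n) (seq x N))
        (ℚ.∣p+q∣≤∣p∣+∣q∣ (seq x n ℚ.- seq x N) (seq x N)))
      (ℚ.+-monoˡ-< ∣ seq x N ∣ (close n N N≤n ℕ.≤-refl))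

  max₁ : ∀ {m n k} → m ℕ.⊔ n ℕ.≤ k → m ℕ.≤ k
  max₁ {m} {n} = ℕ.m⊔n≤o⇒m≤o m n

  max₂ : ∀ {m n k} → m ℕ.⊔ n ℕ.≤ k → n ℕ.≤ k
  max₂ {m} {n} = ℕ.m⊔n≤o⇒n≤o m n

open Estimates

constℝ : ℚ → ℝ
constℝ q .seq _ = q
constℝ q .cauchy ε 0<ε = 0 , λ _ _ _ _ → subst (λ d → ∣ d ∣ ℚ.< ε) (sym (ℚ.+-inverseʳ q)) 0<ε

infixl 6 _+ℝ_
infixl 7 _*ℝ_
infix  8 -ℝ_

_+ℝ_ _*ℝ_ : ℝ → ℝ → ℝ
-ℝ_ : ℝ → ℝ

(x +ℝ y) .seq n = seq x n ℚ.+ seq y n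
(x +ℝ y) .cauchy ε 0<ε =
  let N₁ , cx = cauchy x (½ ℚ.* ε) (half-pos 0<ε)
      N₂ , cy = cauchy y (½ ℚ.* ε) (half-pos 0<ε)
  in N₁ ℕ.⊔ N₂ , λ m n ≤m ≤n → subst (λ d → ∣ d ∣ ℚ.< ε)
       (sub-+ (seq x m) (seq x n) (seq y m) (seq y n))
       (sum-small (seq x m ℚ.- seq x n) (seq y m ℚ.- seq y n)
         (cx m n (max₁ ≤m) (max₁ ≤n)) (cy m n (max₂ {N₁} ≤m) (max₂ {N₁} ≤n)))

(-ℝ x) .seq n = ℚ.- seq x n
(-ℝ x) .cauchy ε 0<ε =
  let N , cx = cauchy x ε 0<ε
  in N , λ m n ≤m ≤n → subst (λ d → ∣ d ∣ ℚ.< ε) (sub-neg (seq x m) (seq x n)) (cx n m ≤n ≤m)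

(x *ℝ y) .seq n = seq x n ℚ.* seq y n
(x *ℝ y) .cauchy ε 0<ε =
  let B , 0<B , N₁ , x< = bound x
      C , 0<C , N₂ , y< = bound y
      N₃ , cx = cauchy x (δ 0<ε 0<B 0<C) (0<δ 0<ε 0<B 0<C)
      N₄ , cy = cauchy y (δ 0<ε 0<B 0<C) (0<δ 0<ε 0<B 0<C)
  in (N₁ ℕ.⊔ N₂) ℕ.⊔ (N₃ ℕ.⊔ N₄) , λ m n ≤m ≤n →
       product-close 0<ε 0<B 0<C (seq x m) (seq y m) (seq x n) (seq y n)
         (x< m (max₁ (max₁ ≤m)))
         (y< n (max₂ {N₁} (max₁ ≤n)))
         (cx m n (max₁ (max₂ {N₁ ℕ.⊔ N₂} ≤m)) (max₁ (max₂ {N₁ ℕ.⊔ N₂} ≤n)))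
         (cy m n (max₂ {N₃} (max₂ {N₁ ℕ.⊔ N₂} ≤m)) (max₂ {N₃} (max₂ {N₁ ℕ.⊔ N₂} ≤n)))

module RealLaws where
  open +-*-Solver

  pointwise : ∀ {x y} → (∀ n → seq x n ≡ seq y n) → x ≈ℝ y
  pointwise eq = vanishing λ ε 0<ε →
    0 , λ n _ → subst (λ d → ∣ d ∣ ℚ.< ε) (sym (sub-self (eq n))) 0<ε

  ≈ℝ-sym : ∀ {x y} → x ≈ℝ y → y ≈ℝ x
  ≈ℝ-sym {x} {y} x≈y = vanishing λ ε 0<ε →
    let N , p = close x≈y ε 0<ε
    in N , λ n N≤n → subst (ℚ._< ε) (∣p-q∣≡∣q-p∣ (seq x n) (seq y n)) (p n N≤n)

  ≈ℝ-trans : ∀ {x y z} → x ≈ℝ y → y ≈ℝ z → x ≈ℝ z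
  ≈ℝ-trans {x} {y} {z} x≈y y≈z = vanishing λ ε 0<ε →
    let N₁ , p = close x≈y (½ ℚ.* ε) (half-pos 0<ε)
        N₂ , q = close y≈z (½ ℚ.* ε) (half-pos 0<ε)
    in N₁ ℕ.⊔ N₂ , λ n ≤n → subst (λ d → ∣ d ∣ ℚ.< ε)
         (solve 3 (λ a b c → (a :- b) :+ (b :- c) := a :- c) refl (seq x n) (seq y n) (seq z n))
         (sum-small (seq x n ℚ.- seq y n) (seq y n ℚ.- seq z n)
           (p n (max₁ ≤n)) (q n (max₂ {N₁} ≤n)))

  +ℝ-cong : ∀ {x x′ y y′} → x ≈ℝ x′ → y ≈ℝ y′ → (x +ℝ y) ≈ℝ (x′ +ℝ y′)
  +ℝ-cong {x} {x′} {y} {y′} x≈ y≈ = vanishing λ ε 0<ε →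
    let N₁ , p = close x≈ (½ ℚ.* ε) (half-pos 0<ε)
        N₂ , q = close y≈ (½ ℚ.* ε) (half-pos 0<ε)
    in N₁ ℕ.⊔ N₂ , λ n ≤n → subst (λ d → ∣ d ∣ ℚ.< ε)
         (sub-+ (seq x n) (seq x′ n) (seq y n) (seq y′ n))
         (sum-small (seq x n ℚ.- seq x′ n) (seq y n ℚ.- seq y′ n)
           (p n (max₁ ≤n)) (q n (max₂ {N₁} ≤n)))

  -ℝ-cong : ∀ {x x′} → x ≈ℝ x′ → (-ℝ x) ≈ℝ (-ℝ x′)
  -ℝ-cong {x} {x′} x≈ = vanishing λ ε 0<ε →
    let N , p = close (≈ℝ-sym x≈) ε 0<ε
    in N , λ n ≤n → subst (λ d → ∣ d ∣ ℚ.< ε)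
         (sub-neg (seq x n) (seq x′ n))
         (p n ≤n)

  *ℝ-cong : ∀ {x x′ y y′} → x ≈ℝ x′ → y ≈ℝ y′ → (x *ℝ y) ≈ℝ (x′ *ℝ y′)
  *ℝ-cong {x} {x′} {y} {y′} x≈ y≈ = vanishing λ ε 0<ε →
    let B , 0<B , N₁ , x<  = bound x
        C , 0<C , N₂ , y′< = bound y′
        N₃ , p = close x≈ (δ 0<ε 0<B 0<C) (0<δ 0<ε 0<B 0<C)
        N₄ , q = close y≈ (δ 0<ε 0<B 0<C) (0<δ 0<ε 0<B 0<C)
    in (N₁ ℕ.⊔ N₂) ℕ.⊔ (N₃ ℕ.⊔ N₄) , λ n ≤n →
         product-close 0<ε 0<B 0<C (seq x n) (seq y n) (seq x′ n) (seq y′ n)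
           (x< n (max₁ (max₁ ≤n)))
           (y′< n (max₂ {N₁} (max₁ ≤n)))
           (p n (max₁ (max₂ {N₁ ℕ.⊔ N₂} ≤n)))
           (q n (max₂ {N₃} (max₂ {N₁ ℕ.⊔ N₂} ≤n)))

  isCommutativeRing : IsCommutativeRing _≈ℝ_ _+ℝ_ _*ℝ_ -ℝ_ (constℝ 0ℚ) (constℝ 1ℚ)
  isCommutativeRing = record
    { isRing = record
      { +-isAbelianGroup = record
        { isGroup = record
          { isMonoid = record
            { isSemigroup = record
              { isMagma = record
                { isEquivalence = record
                  { refl = pointwise λ _ → refl ; sym = ≈ℝ-sym ; trans = ≈ℝ-trans }
                ; ∙-cong = +ℝ-cong
                }
              ; assoc = λ x y z → pointwise λ n → ℚ.+-assoc (seq x n) (seq y n) (seq z n)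
              }
            ; identity = (λ x → pointwise λ n → ℚ.+-identityˡ (seq x n))
                       , (λ x → pointwise λ n → ℚ.+-identityʳ (seq x n))
            }
          ; inverse = (λ x → pointwise λ n → ℚ.+-inverseˡ (seq x n))
                    , (λ x → pointwise λ n → ℚ.+-inverseʳ (seq x n))
          ; ⁻¹-cong = -ℝ-cong
          }
        ; comm = λ x y → pointwise λ n → ℚ.+-comm (seq x n) (seq y n)
        }
      ; *-cong = *ℝ-cong
      ; *-assoc = λ x y z → pointwise λ n → ℚ.*-assoc (seq x n) (seq y n) (seq z n)
      ; *-identity = (λ x → pointwise λ n → ℚ.*-identityˡ (seq x n))
                   , (λ x → pointwise λ n → ℚ.*-identityʳ (seq x n))
      ; distrib = (λ x y z → pointwise λ n → ℚ.*-distribˡ-+ (seq x n) (seq y n) (seq z n))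
                , (λ x y z → pointwise λ n → ℚ.*-distribʳ-+ (seq x n) (seq y n) (seq z n))
      }
    ; *-comm = λ x y → pointwise λ n → ℚ.*-comm (seq x n) (seq y n)
    }

ℝ-commutativeRing : CommutativeRing 0ℓ 0ℓ
ℝ-commutativeRing = record { isCommutativeRing = RealLaws.isCommutativeRing }

record ℂ : Set where
  constructor _+i_
  field
    re im : ℝ

open ℂ using (re; im)

record _≈ℂ_ (z w : ℂ) : Set where
  constructor _,_
  field
    re-≈ : re z ≈ℝ re w
    im-≈ : im z ≈ℝ im w

infix  4 _≈ℂ_
infixl 6 _+ℂ_
infixl 7 _*ℂ_
infix  8 -ℂ_

0ℂ 1ℂ : ℂ
0ℂ = constℝ 0ℚ +i constℝ 0ℚ
1ℂ = constℝ 1ℚ +i constℝ 0ℚ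

_+ℂ_ _*ℂ_ : ℂ → ℂ → ℂ
re (z +ℂ w) = re z +ℝ re w
im (z +ℂ w) = im z +ℝ im w
re (z *ℂ w) = re z *ℝ re w +ℝ -ℝ (im z *ℝ im w)
im (z *ℂ w) = re z *ℝ im w +ℝ im z *ℝ re w

-ℂ_ : ℂ → ℂ
re (-ℂ z) = -ℝ re z
im (-ℂ z) = -ℝ im z

module ComplexLaws where
  open RealLaws using (pointwise)
  module R = CommutativeRing ℝ-commutativeRing

  module Identities where
    open import Algebra.Solver.Ring.NaturalCoefficients.Default
      (CommutativeRing.commutativeSemiring ℚ.+-*-commutativeRing)
    open import Data.Rational.Base using (_+_; _*_; -_)

    m : ℚ
    m = - 1ℚ

    -≡m* : ∀ x → - x ≡ m * x
    -≡m* x = trans (cong -_ (sym (ℚ.*-identityˡ x))) (ℚ.neg-distribˡ-* 1ℚ x)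

    assoc-re : ∀ a b c d e f →
      (a * c + - (b * d)) * e + - ((a * d + b * c) * f) ≡
      a * (c * e + - (d * f)) + - (b * (c * f + d * e))
    assoc-re a b c d e f
      rewrite -≡m* (b * d) | -≡m* ((a * d + b * c) * f) | -≡m* (d * f) | -≡m* (b * (c * f + d * e))
      = solve 7 (λ m a b c d e f →
          (a :* c :+ m :* (b :* d)) :* e :+ m :* ((a :* d :+ b :* c) :* f) :=
          a :* (c :* e :+ m :* (d :* f)) :+ m :* (b :* (c :* f :+ d :* e)))
          refl m a b c d e f

    assoc-im : ∀ a b c d e f →
      (a * c + - (b * d)) * f + (a * d + b * c) * e ≡
      a * (c * f + d * e) + b * (c * e + - (d * f))
    assoc-im a b c d e f
      rewrite -≡m* (b * d) | -≡m* (d * f)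
      = solve 7 (λ m a b c d e f →
          (a :* c :+ m :* (b :* d)) :* f :+ (a :* d :+ b :* c) :* e :=
          a :* (c :* f :+ d :* e) :+ b :* (c :* e :+ m :* (d :* f)))
          refl m a b c d e f

    distribˡ-re : ∀ a b c d e f →
      a * (c + e) + - (b * (d + f)) ≡ (a * c + - (b * d)) + (a * e + - (b * f))
    distribˡ-re a b c d e f
      rewrite -≡m* (b * (d + f)) | -≡m* (b * d) | -≡m* (b * f)
      = solve 7 (λ m a b c d e f →
          a :* (c :+ e) :+ m :* (b :* (d :+ f)) :=
          (a :* c :+ m :* (b :* d)) :+ (a :* e :+ m :* (b :* f)))
          refl m a b c d e f

    distribˡ-im : ∀ a b c d e f →
      a * (d + f) + b * (c + e) ≡ (a * d + b * c) + (a * f + b * e)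
    distribˡ-im = solve 6 (λ a b c d e f →
      a :* (d :+ f) :+ b :* (c :+ e) := (a :* d :+ b :* c) :+ (a :* f :+ b :* e)) refl

    identityˡ-re : ∀ a b → 1ℚ * a + - (0ℚ * b) ≡ a
    identityˡ-re a b rewrite ℚ.*-identityˡ a | ℚ.*-zeroˡ b = ℚ.+-identityʳ a

    identityˡ-im : ∀ a b → 1ℚ * b + 0ℚ * a ≡ b
    identityˡ-im a b rewrite ℚ.*-identityˡ b | ℚ.*-zeroˡ a = ℚ.+-identityʳ b

    comm-im : ∀ a b c d → a * d + b * c ≡ c * b + d * a
    comm-im = solve 4 (λ a b c d → a :* d :+ b :* c := c :* b :+ d :* a) refl

  open Identities

  +ℂ-isAbelianGroup : IsAbelianGroup _≈ℂ_ _+ℂ_ 0ℂ -ℂ_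
  +ℂ-isAbelianGroup = record
    { isGroup = record
      { isMonoid = record
        { isSemigroup = record
          { isMagma = record
            { isEquivalence = record
              { refl  = R.refl , R.refl
              ; sym   = λ (p , q) → R.sym p , R.sym q
              ; trans = λ (p , q) (p′ , q′) → R.trans p p′ , R.trans q q′
              }
            ; ∙-cong = λ (p , q) (p′ , q′) → R.+-cong p p′ , R.+-cong q q′
            }
          ; assoc = λ (a +i b) (c +i d) (e +i f) → R.+-assoc a c e , R.+-assoc b d f
          }
        ; identity = (λ (a +i b) → R.+-identityˡ a , R.+-identityˡ b)
                   , (λ (a +i b) → R.+-identityʳ a , R.+-identityʳ b)
        }
      ; inverse = (λ (a +i b) → R.-‿inverseˡ a , R.-‿inverseˡ b)
                , (λ (a +i b) → R.-‿inverseʳ a , R.-‿inverseʳ b)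
      ; ⁻¹-cong = λ (p , q) → R.-‿cong p , R.-‿cong q
      }
    ; comm = λ (a +i b) (c +i d) → R.+-comm a c , R.+-comm b d
    }

  ℂ-setoid : Setoid 0ℓ 0ℓ
  ℂ-setoid = record { isEquivalence = IsAbelianGroup.isEquivalence +ℂ-isAbelianGroup }

  open Consequences ℂ-setoid

  *ℂ-cong : ∀ {x x′ y y′} → x ≈ℂ x′ → y ≈ℂ y′ → (x *ℂ y) ≈ℂ (x′ *ℂ y′)
  *ℂ-cong (p , q) (p′ , q′) =
    R.+-cong (R.*-cong p p′) (R.-‿cong (R.*-cong q q′)) ,
    R.+-cong (R.*-cong p q′) (R.*-cong q p′)

  *ℂ-assoc : ∀ x y z → ((x *ℂ y) *ℂ z) ≈ℂ (x *ℂ (y *ℂ z))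
  *ℂ-assoc (a +i b) (c +i d) (e +i f) =
    pointwise (λ n → assoc-re (seq a n) (seq b n) (seq c n) (seq d n) (seq e n) (seq f n)) ,
    pointwise (λ n → assoc-im (seq a n) (seq b n) (seq c n) (seq d n) (seq e n) (seq f n))

  *ℂ-comm : ∀ x y → (x *ℂ y) ≈ℂ (y *ℂ x)
  *ℂ-comm (a +i b) (c +i d) =
    R.+-cong (R.*-comm a c) (R.-‿cong (R.*-comm b d)) ,
    pointwise (λ n → comm-im (seq a n) (seq b n) (seq c n) (seq d n))

  *ℂ-identityˡ : ∀ x → (1ℂ *ℂ x) ≈ℂ x
  *ℂ-identityˡ (a +i b) =
    pointwise (λ n → identityˡ-re (seq a n) (seq b n)) ,
    pointwise (λ n → identityˡ-im (seq a n) (seq b n))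

  *ℂ-distribˡ : ∀ x y z → (x *ℂ (y +ℂ z)) ≈ℂ (x *ℂ y +ℂ x *ℂ z)
  *ℂ-distribˡ (a +i b) (c +i d) (e +i f) =
    pointwise (λ n → distribˡ-re (seq a n) (seq b n) (seq c n) (seq d n) (seq e n) (seq f n)) ,
    pointwise (λ n → distribˡ-im (seq a n) (seq b n) (seq c n) (seq d n) (seq e n) (seq f n))

  isCommutativeRing : IsCommutativeRing _≈ℂ_ _+ℂ_ _*ℂ_ -ℂ_ 0ℂ 1ℂ
  isCommutativeRing = record
    { isRing = record
      { +-isAbelianGroup = +ℂ-isAbelianGroup
      ; *-cong           = *ℂ-cong
      ; *-assoc          = *ℂ-assoc
      ; *-identity       = comm∧idˡ⇒id *ℂ-comm *ℂ-identityˡ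
      ; distrib          = comm∧distrˡ⇒distr (IsAbelianGroup.∙-cong +ℂ-isAbelianGroup)
                             *ℂ-comm *ℂ-distribˡ
      }
    ; *-comm = *ℂ-comm
    }

ℂ-commutativeRing : CommutativeRing 0ℓ 0ℓ
ℂ-commutativeRing = record { isCommutativeRing = ComplexLaws.isCommutativeRing }

module _ (R : CommutativeRing c ℓ) where
  open CommutativeRing R renaming (refl to ≈-refl; sym to ≈-sym; trans to ≈-trans)
  open RingProperties ring
  open ≈-Reasoning setoid

  IsUnit : Pred Carrier (c ⊔ ℓ)
  IsUnit = Invertible _≈_ 1# _*_

  private
    Rˣ : Set (c ⊔ ℓ)
    Rˣ = Σ Carrier IsUnit

    inverse-unique : ((x , _) (y , _) : Rˣ) → x ≈ y → ∀ {x⁻¹ y⁻¹} →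
                     x⁻¹ * x ≈ 1# → y * y⁻¹ ≈ 1# → x⁻¹ ≈ y⁻¹
    inverse-unique (x , _) (y , _) x≈y {x⁻¹} {y⁻¹} x⁻¹x yy⁻¹ = begin
      x⁻¹             ≈⟨ *-identityʳ x⁻¹ ⟨
      x⁻¹ * 1#        ≈⟨ *-congˡ yy⁻¹ ⟨
      x⁻¹ * (y * y⁻¹) ≈⟨ *-assoc x⁻¹ y y⁻¹ ⟨
      x⁻¹ * y * y⁻¹   ≈⟨ *-congʳ (*-congˡ x≈y) ⟨
      x⁻¹ * x * y⁻¹   ≈⟨ *-congʳ x⁻¹x ⟩
      1# * y⁻¹        ≈⟨ *-identityˡ y⁻¹ ⟩
      y⁻¹             ∎

    product-inverse : ∀ {a b a⁻¹ b⁻¹} → a⁻¹ * a ≈ 1# → b⁻¹ * b ≈ 1# →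
                      (b⁻¹ * a⁻¹) * (a * b) ≈ 1#
    product-inverse {a} {b} {a⁻¹} {b⁻¹} p q = begin
      (b⁻¹ * a⁻¹) * (a * b) ≈⟨ *-assoc b⁻¹ a⁻¹ (a * b) ⟩
      b⁻¹ * (a⁻¹ * (a * b)) ≈⟨ *-congˡ (*-assoc a⁻¹ a b) ⟨
      b⁻¹ * (a⁻¹ * a * b)   ≈⟨ *-congˡ (*-congʳ p) ⟩
      b⁻¹ * (1# * b)        ≈⟨ *-congˡ (*-identityˡ b) ⟩
      b⁻¹ * b               ≈⟨ q ⟩
      1#                    ∎

  unitGroup : AbelianGroup (c ⊔ ℓ) ℓ
  unitGroup = record
    { Carrier = Rˣ
    ; _≈_     = λ (x , _) (y , _) → x ≈ y
    ; _∙_     = λ (x , x⁻¹ , x⁻¹x , xx⁻¹) (y , y⁻¹ , y⁻¹y , yy⁻¹) →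
                  x * y , y⁻¹ * x⁻¹ , product-inverse x⁻¹x y⁻¹y , product-inverse yy⁻¹ xx⁻¹
    ; ε       = 1# , 1# , *-identityˡ 1# , *-identityˡ 1#
    ; _⁻¹     = λ (x , x⁻¹ , x⁻¹x , xx⁻¹) → x⁻¹ , x , xx⁻¹ , x⁻¹x
    ; isAbelianGroup = record
      { isGroup = record
        { isMonoid = record
          { isSemigroup = record
            { isMagma = record
              { isEquivalence = record { refl = ≈-refl ; sym = ≈-sym ; trans = ≈-trans }
              ; ∙-cong = *-cong
              }
            ; assoc = λ (x , _) (y , _) (z , _) → *-assoc x y z
            }
          ; identity = (λ (x , _) → *-identityˡ x) , (λ (x , _) → *-identityʳ x)
          }
        ; inverse = (λ (_ , _ , x⁻¹x , _) → x⁻¹x) , (λ (_ , _ , _ , xx⁻¹) → xx⁻¹)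
        ; ⁻¹-cong = λ {u@(_ , _ , x⁻¹x , _)} {v@(_ , _ , _ , yy⁻¹)} x≈y →
            inverse-unique u v x≈y x⁻¹x yy⁻¹
        }
      ; comm = λ (x , _) (y , _) → *-comm x y
      }
    }

  IsField : Set (c ⊔ ℓ)
  IsField = ¬ (1# ≈ 0#) × (∀ x → ¬ (x ≈ 0#) → IsUnit x)

  IsFinite : Set (c ⊔ ℓ)
  IsFinite = ∃[ n ] Inverse (Fin.≡-setoid n) setoid

  -- The kernel of ℤ → R is generated by m.
  HasCharacteristic : ℕ → Set ℓ
  HasCharacteristic m = ∀ n → (n · 1# ≈ 0#) ⇔ (m ∣ n)
    where open RawMonoidDefs +-rawMonoid using () renaming (_×_ to _·_)

  record Ideal p : Set (c ⊔ ℓ ⊔ suc p) where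
    infix 4 _∈I
    field
      _∈I      : Pred Carrier p
      ∈-resp-≈ : ∀ {x y} → x ≈ y → x ∈I → y ∈I
      0∈       : 0# ∈I
      +-closed : ∀ {x y} → x ∈I → y ∈I → x + y ∈I
      *-closed : ∀ r {x} → x ∈I → r * x ∈I

module _ {R : CommutativeRing c ℓ} where
  open CommutativeRing R using (Carrier)

  infix 4 _∈_ _⊆_

  _∈_ : Carrier → Ideal R p → Set p
  _∈_ x I = Ideal._∈I I x

  _⊆_ : Ideal R p → Ideal R q → Set (c ⊔ p ⊔ q)
  I ⊆ J = ∀ {x} → x ∈ I → x ∈ J

module _ (R : CommutativeRing c ℓ) where
  open CommutativeRing R renaming (refl to ≈-refl; sym to ≈-sym; trans to ≈-trans)
  open RingProperties ring
  open ≈-Reasoning setoid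

  zeroIdeal : Ideal R ℓ
  zeroIdeal = record
    { _∈I      = _≈ 0#
    ; ∈-resp-≈ = λ x≈y x≈0 → ≈-trans (≈-sym x≈y) x≈0
    ; 0∈       = ≈-refl
    ; +-closed = λ x≈0 y≈0 → ≈-trans (+-cong x≈0 y≈0) (+-identityˡ 0#)
    ; *-closed = λ r x≈0 → ≈-trans (*-congˡ x≈0) (zeroʳ r)
    }

  IsWhole : Ideal R p → Set (c ⊔ p)
  IsWhole I = ∀ x → x ∈ I

  -- "J ⊇ I implies J = I or J = R", phrased without a disjunction: membership in
  -- J need not be decidable.
  IsMaximal : Ideal R (c ⊔ ℓ) → Set (suc (c ⊔ ℓ))
  IsMaximal I = ¬ IsWhole I × (∀ (J : Ideal R (c ⊔ ℓ)) → ¬ IsWhole J → I ⊆ J → J ⊆ I)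

  record IsLocal : Set (suc (c ⊔ ℓ)) where
    field
      M         : Ideal R (c ⊔ ℓ)
      M-maximal : IsMaximal M
      M-unique  : ∀ (J : Ideal R (c ⊔ ℓ)) → IsMaximal J → J ⊆ M × M ⊆ J

  quotient : Ideal R p → CommutativeRing c p
  quotient {p = p} I = record
    { Carrier = Carrier
    ; _≈_     = _~_
    ; _+_     = _+_
    ; _*_     = _*_
    ; -_      = -_
    ; 0#      = 0#
    ; 1#      = 1#
    ; isCommutativeRing = record
      { isRing = record
        { +-isAbelianGroup = record
          { isGroup = record
            { isMonoid = record
              { isSemigroup = record
                { isMagma = record
                  { isEquivalence = record { refl = ~-reflexive ≈-refl ; sym = ~-sym ; trans = ~-trans }
                  ; ∙-cong = ~-+-cong
                  }
                ; assoc = λ x y z → ~-reflexive (+-assoc x y z)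
                }
              ; identity = (λ x → ~-reflexive (+-identityˡ x)) , (λ x → ~-reflexive (+-identityʳ x))
              }
            ; inverse = (λ x → ~-reflexive (-‿inverseˡ x)) , (λ x → ~-reflexive (-‿inverseʳ x))
            ; ⁻¹-cong = ~-neg-cong
            }
          ; comm = λ x y → ~-reflexive (+-comm x y)
          }
        ; *-cong = ~-*-cong
        ; *-assoc = λ x y z → ~-reflexive (*-assoc x y z)
        ; *-identity = (λ x → ~-reflexive (*-identityˡ x)) , (λ x → ~-reflexive (*-identityʳ x))
        ; distrib = (λ x y z → ~-reflexive (distribˡ x y z)) , (λ x y z → ~-reflexive (distribʳ x y z))
        }
      ; *-comm = λ x y → ~-reflexive (*-comm x y)
      }
    }
    where
    open Ideal I using (∈-resp-≈; 0∈; +-closed; *-closed)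

    _~_ : Carrier → Carrier → Set p
    x ~ y = x - y ∈ I

    ~-reflexive : ∀ {x y} → x ≈ y → x ~ y
    ~-reflexive {x} {y} x≈y =
      ∈-resp-≈ (≈-sym (≈-trans (+-congʳ x≈y) (-‿inverseʳ y))) 0∈

    neg-closed : ∀ {x} → x ∈ I → - x ∈ I
    neg-closed {x} x∈I = ∈-resp-≈ (-1*x≈-x x) (*-closed (- 1#) x∈I)

    ~-sym : ∀ {x y} → x ~ y → y ~ x
    ~-sym {x} {y} x~y = ∈-resp-≈ (⁻¹-anti-homo‿- x y) (neg-closed x~y)

    ~-trans : ∀ {x y z} → x ~ y → y ~ z → x ~ z
    ~-trans {x} {y} {z} x~y y~z = ∈-resp-≈ telescope (+-closed x~y y~z)
      where
      telescope : (x - y) + (y - z) ≈ x - z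
      telescope = begin
        (x - y) + (y - z)   ≈⟨ +-assoc x (- y) (y - z) ⟩
        x + (- y + (y - z)) ≈⟨ +-congˡ (+-assoc (- y) y (- z)) ⟨
        x + (- y + y - z)   ≈⟨ +-congˡ (+-congʳ (-‿inverseˡ y)) ⟩
        x + (0# - z)        ≈⟨ +-congˡ (+-identityˡ (- z)) ⟩
        x - z               ∎

    ~-+-congˡ : ∀ x {y z} → y ~ z → (x + y) ~ (x + z)
    ~-+-congˡ x {y} {z} y~z = ∈-resp-≈ (≈-sym cancel) y~z
      where
      cancel : (x + y) - (x + z) ≈ y - z
      cancel = begin
        (x + y) - (x + z)       ≈⟨ +-congˡ (-‿+-comm x z) ⟨
        (x + y) + (- x - z)     ≈⟨ +-congʳ (+-comm x y) ⟩
        (y + x) + (- x - z)     ≈⟨ +-assoc y x (- x - z) ⟩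
        y + (x + (- x - z))     ≈⟨ +-congˡ (+-assoc x (- x) (- z)) ⟨
        y + (x - x - z)         ≈⟨ +-congˡ (+-congʳ (-‿inverseʳ x)) ⟩
        y + (0# - z)            ≈⟨ +-congˡ (+-identityˡ (- z)) ⟩
        y - z                   ∎

    ~-+-cong : ∀ {x x′ y y′} → x ~ x′ → y ~ y′ → (x + y) ~ (x′ + y′)
    ~-+-cong {x} {x′} {y} {y′} x~x′ y~y′ =
      ~-trans (~-+-congˡ x y~y′)
        (~-trans (~-reflexive (+-comm x y′))
          (~-trans (~-+-congˡ y′ x~x′) (~-reflexive (+-comm y′ x′))))

    ~-*-congˡ : ∀ x {y z} → y ~ z → (x * y) ~ (x * z)
    ~-*-congˡ x {y} {z} y~z =
      ∈-resp-≈ (≈-trans (distribˡ x y (- z)) (+-congˡ (≈-sym (-‿distribʳ-* x z)))) (*-closed x y~z)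

    ~-*-cong : ∀ {x x′ y y′} → x ~ x′ → y ~ y′ → (x * y) ~ (x′ * y′)
    ~-*-cong {x} {x′} {y} {y′} x~x′ y~y′ =
      ~-trans (~-*-congˡ x y~y′)
        (~-trans (~-reflexive (*-comm x y′))
          (~-trans (~-*-congˡ y′ x~x′) (~-reflexive (*-comm y′ x′))))

    ~-neg-cong : ∀ {x y} → x ~ y → (- x) ~ (- y)
    ~-neg-cong {x} {y} x~y = ∈-resp-≈ (≈-sym (-‿+-comm x (- y))) (neg-closed x~y)

-- "Odd characteristic" of a local ring refers to its residue field R/M.
HasOddCharacteristic : (R : CommutativeRing c ℓ) → IsLocal R → Set (c ⊔ ℓ)
HasOddCharacteristic R local =
  ∃[ m ] HasCharacteristic (quotient R (IsLocal.M local)) m × ¬ (2 ∣ m)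

-- Constructively, the non-zero complex numbers are the invertible ones
-- (those apart from 0).
ℂˣ : AbelianGroup 0ℓ 0ℓ
ℂˣ = unitGroup ℂ-commutativeRing

record Character {g ℓ} (G : AbelianGroup g ℓ) : Set (g ⊔ ℓ) where
  open AbelianGroup G using (Carrier; rawGroup)
  open GroupMorphisms rawGroup (AbelianGroup.rawGroup ℂˣ)
  field
    χ              : Carrier → AbelianGroup.Carrier ℂˣ
    isHomomorphism : IsGroupHomomorphism χ

  value : Carrier → ℂ
  value x = proj₁ (χ x)

open Character using (value)

module _ (R : CommutativeRing c ℓ) where
  open CommutativeRing R

  Units : Set (c ⊔ ℓ)
  Units = AbelianGroup.Carrier (unitGroup R)

  IsSquareOfUnit : Pred Carrier (c ⊔ ℓ)
  IsSquareOfUnit a = ∃[ u ] a ≈ proj₁ (u ∙ u)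
    where open AbelianGroup (unitGroup R) using (_∙_)

  AdditiveCharacter : Set (c ⊔ ℓ)
  AdditiveCharacter = Character +-abelianGroup

  MultiplicativeCharacter : Set (c ⊔ ℓ)
  MultiplicativeCharacter = Character (unitGroup R)

  IsPrimitiveAdditive : AdditiveCharacter → Set (suc (c ⊔ ℓ))
  IsPrimitiveAdditive ψ =
    ∀ (I : Ideal R (c ⊔ ℓ)) → (∀ x → x ∈ I → value ψ x ≈ℂ 1ℂ) → I ⊆ zeroIdeal R

  IsFrobenius : Set (suc (c ⊔ ℓ))
  IsFrobenius = Σ AdditiveCharacter IsPrimitiveAdditive

  IsTrivial : MultiplicativeCharacter → Set (c ⊔ ℓ)
  IsTrivial τ = ∀ u → value τ u ≈ℂ 1ℂ

  -- τ is identically 1 on 1+I.  Used only for I ⊆ M, where 1+I consists of units.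
  IsTrivialOn1+ : ∀ {p} → MultiplicativeCharacter → Ideal R p → Set (c ⊔ ℓ ⊔ p)
  IsTrivialOn1+ τ I =
    ∀ x → x ∈ I → ∀ (u : Units) → proj₁ u ≈ 1# + x → value τ u ≈ℂ 1ℂ

  module _ (local : IsLocal R) where
    open IsLocal local using (M)

    IsConductor : ∀ {p} → MultiplicativeCharacter → Ideal R p → Set (suc (c ⊔ ℓ) ⊔ p)
    IsConductor τ I =
        (IsTrivial τ × IsWhole R I)
      ⊎ (¬ IsTrivial τ
        × I ⊆ M
        × IsTrivialOn1+ τ I
        × (∀ (J : Ideal R (c ⊔ ℓ)) → J ⊆ M → IsTrivialOn1+ τ J → J ⊆ I))

    IsPrimitiveMultiplicative : MultiplicativeCharacter → Set (suc (c ⊔ ℓ))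
    IsPrimitiveMultiplicative τ = IsConductor τ (zeroIdeal R)

module _ (R : CommutativeRing c ℓ) (finite : IsFinite R) where
  open CommutativeRing R renaming (trans to ≈-trans)
  open Inverse (proj₂ finite) using ()
    renaming (to to element; from to index; strictlyInverseˡ to element-index)

  infix 4 _≟_

  _≟_ : Decidable _≈_
  _≟_ = Dec.via-injection
    (InverseProperties.Inverse⇒Injection (InverseProperties.sym (proj₂ finite))) Fin._≟_

  isUnit? : ∀ x → Dec (IsUnit R x)
  isUnit? x = Dec.map′
    (λ (i , inverses) → element i , inverses)
    (λ (y , yx , xy) → index y ,
      ≈-trans (*-congʳ (element-index y)) yx , ≈-trans (*-congˡ (element-index y)) xy)
    (Fin.any? λ i → (element i * x ≟ 1#) Dec.×-dec (x * element i ≟ 1#))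

  extendByZero : (Units R → ℂ) → Carrier → ℂ
  extendByZero f x with isUnit? x
  ... | yes u = f (x , u)
  ... | no  _ = 0ℂ

  -- The sum over Rˣ, computed as a sum over the enumeration of R.
  sumUnits : (Units R → ℂ) → ℂ
  sumUnits f = sum λ i → extendByZero f (element i)
    where open RawMonoidDefs (CommutativeRing.+-rawMonoid ℂ-commutativeRing) using (sum)

  kloosterman : AdditiveCharacter R → MultiplicativeCharacter R → Carrier → ℂ
  kloosterman ψ τ a =
    sumUnits λ u@(x , x⁻¹ , _) → value τ u *ℂ value ψ (x + a * x⁻¹)

module Submission where

-- A non-primitive τ is trivial on 1 + I for some nonzero ideal I ⊆ M (if τ itself is
-- trivial, take I = M, which is nonzero because R is not a field).  As the elements of M are
-- nilpotent, I contains some s ≠ 0 with sM = 0.  For y ∈ R the unit 1 + sy has inverse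
-- 1 - sy, so substituting u(1 + sy) for u and summing over y gives
--   |R| K(a) = Σ_u τ(u) ψ(u + au⁻¹) Σ_y ψ(s(u - au⁻¹)y).
-- Primitivity of ψ makes the inner sum vanish unless u - au⁻¹ ∈ M.  The latter is
-- impossible for a ∈ M, and in odd characteristic it makes a a square, since
-- a = u²(1 - m) with m ∈ M and Newton iteration extracts a square root of 1 - m.
--
-- Classical reasoning is harmless because z ≈ℂ 0ℂ is stable under double negation.

open import Defs
open import Algebra.Bundles using (CommutativeRing; AbelianGroup)
open import Algebra.Morphism.Structures using (module GroupMorphisms)
import Algebra.Properties.Ring as RingProperties
import Algebra.Properties.Semiring.Exp as Exp
import Algebra.Properties.Semiring.Mult as Mult
import Algebra.Properties.Semiring.Sum as Sum
import Algebra.Solver.Ring.NaturalCoefficients.Default as Solver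
open import Data.Fin.Base using (Fin; zero; suc; toℕ)
import Data.Fin.Properties as Fin
open import Data.Nat.Base as ℕ using (ℕ; zero; suc)
import Data.Nat.Divisibility as ℕ
import Data.Nat.Properties as ℕ
open import Data.Product.Base using (_×_; _,_; proj₁; proj₂; ∃-syntax)
open import Data.Rational.Base as ℚ using (ℚ; 0ℚ; 1ℚ; ½; ∣_∣)
import Data.Rational.Properties as ℚ
open import Data.Rational.Solver using (module +-*-Solver)
open import Data.Sum.Base using (_⊎_; inj₁; inj₂)
open import Function.Base using (_∘_)
open import Function.Bundles using (Inverse; Equivalence)
import Function.Properties.Inverse as InverseProperties
open import Level using (Level; _⊔_)
import Relation.Binary.PropositionalEquality as ≡
open ≡ using (_≡_)
import Relation.Binary.Reasoning.Setoid as ≈-Reasoning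
open import Relation.Nullary
  using (¬_; Dec; yes; no; contradiction; decidable-stable; Stable; ¬¬-map; ¬¬-excluded-middle)
import Relation.Nullary.Decidable as Dec
open import Relation.Unary using (Pred; Decidable)

private
  variable
    c ℓ p : Level

  module ℝR = CommutativeRing ℝ-commutativeRing
  module ℂR = CommutativeRing ℂ-commutativeRing
  module ℂ≈ = ≈-Reasoning ℂR.setoid

-- Real and complex numbers

open ℝ using (seq; cauchy)
open ℂ using (re; im)
open _≈ℝ_ using (close)
open Estimates using (half-pos; halves; sum-small; max₁; max₂)
open RealLaws using (pointwise)

EventuallySmall : ℝ → ℚ → Set
EventuallySmall x ε = ∃[ N ] (∀ n → N ℕ.≤ n → ∣ seq x n ∣ ℚ.< ε)

-- Apartness from 0: the positive form of `¬ x ≈ℝ 0ℝ`, supplying a bound that can be divided by.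
BoundedAway : ℝ → Set
BoundedAway x = ∃[ B ] 0ℚ ℚ.< B × ∃[ N ] (∀ n → N ℕ.≤ n → B ℚ.≤ ∣ seq x n ∣)

p-q+q≡p : ∀ p q → (p ℚ.- q) ℚ.+ q ≡ p
p-q+q≡p = solve 2 (λ p q → (p :- q) :+ q := p) ≡.refl
  where open +-*-Solver

-- One term x_N, taken where the sequence varies by less than ε/4, decides: below ε/2 it keeps the
-- tail under ε, otherwise the tail stays at or above ε/4. Only rationals are compared.
small⊎away : ∀ x {ε} → 0ℚ ℚ.< ε → EventuallySmall x ε ⊎ BoundedAway x
small⊎away x {ε} 0<ε
  with N , near ← cauchy x (½ ℚ.* (½ ℚ.* ε)) (half-pos (half-pos 0<ε))
  with ∣ seq x N ∣ ℚ.<? ½ ℚ.* ε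
... | yes xN<ε/2 = inj₁ (N , λ n N≤n → ≡.subst (λ d → ∣ d ∣ ℚ.< ε)
        (p-q+q≡p (seq x n) (seq x N))
        (sum-small (seq x n ℚ.- seq x N) (seq x N)
          (ℚ.<-trans (near n N N≤n ℕ.≤-refl) quarter<half) xN<ε/2))
  where
  quarter<half : ½ ℚ.* (½ ℚ.* ε) ℚ.< ½ ℚ.* ε
  quarter<half = ℚ.*-monoʳ-<-pos ½
    (≡.subst (½ ℚ.* ε ℚ.<_) (halves ε)
      (≡.subst (ℚ._< ½ ℚ.* ε ℚ.+ ½ ℚ.* ε) (ℚ.+-identityʳ (½ ℚ.* ε))
        (ℚ.+-monoʳ-< (½ ℚ.* ε) (half-pos 0<ε))))
... | no xN≮ε/2 = inj₂ (½ ℚ.* (½ ℚ.* ε) , half-pos (half-pos 0<ε) , N , λ n N≤n →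
        ℚ.≮⇒≥ λ xn<ε/4 → xN≮ε/2 (≡.subst (λ d → ∣ d ∣ ℚ.< ½ ℚ.* ε)
          (p-q+q≡p (seq x N) (seq x n))
          (sum-small (seq x N ℚ.- seq x n) (seq x n) (near N n ℕ.≤-refl N≤n) xn<ε/4)))

0ℝ : ℝ
0ℝ = constℝ 0ℚ

small⇒≈0 : ∀ {x} → (∀ ε → 0ℚ ℚ.< ε → EventuallySmall x ε) → x ≈ℝ 0ℝ
small⇒≈0 {x} small = vanishing λ ε 0<ε →
  let N , <ε = small ε 0<ε
  in N , λ n N≤n → ≡.subst (λ d → ∣ d ∣ ℚ.< ε) (≡.sym (ℚ.+-identityʳ (seq x n))) (<ε n N≤n)

≈0⇒small : ∀ {x} → x ≈ℝ 0ℝ → ∀ ε → 0ℚ ℚ.< ε → EventuallySmall x ε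
≈0⇒small {x} x≈0 ε 0<ε =
  let N , <ε = close x≈0 ε 0<ε
  in N , λ n N≤n → ≡.subst (λ d → ∣ d ∣ ℚ.< ε) (ℚ.+-identityʳ (seq x n)) (<ε n N≤n)

away⇒≉0 : ∀ {x} → BoundedAway x → ¬ x ≈ℝ 0ℝ
away⇒≉0 {x} (B , 0<B , N₁ , B≤) x≈0 =
  let N₂ , <B = ≈0⇒small x≈0 B 0<B
  in ℚ.<-irrefl ≡.refl (ℚ.<-≤-trans (<B (N₁ ℕ.⊔ N₂) (ℕ.m≤n⊔m N₁ N₂)) (B≤ (N₁ ℕ.⊔ N₂) (ℕ.m≤m⊔n N₁ N₂)))

≉0⇒¬¬away : ∀ {x} → ¬ x ≈ℝ 0ℝ → ¬ ¬ BoundedAway x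
≉0⇒¬¬away {x} x≉0 ¬away = x≉0 (small⇒≈0 small)
  where
  small : ∀ ε → 0ℚ ℚ.< ε → EventuallySmall x ε
  small ε 0<ε with small⊎away x 0<ε
  ... | inj₁ s    = s
  ... | inj₂ away = contradiction away ¬away

-- For each ε the second outcome of `small⊎away` is refuted by the double negation, so the first one
-- holds.
≈0-stable : ∀ {x} → Stable (x ≈ℝ 0ℝ)
≈0-stable {x} ¬¬x≈0 = small⇒≈0 small
  where
  small : ∀ ε → 0ℚ ℚ.< ε → EventuallySmall x ε
  small ε 0<ε with small⊎away x 0<ε
  ... | inj₁ s    = s
  ... | inj₂ away = contradiction (away⇒≉0 away) ¬¬x≈0

away-cancel : ∀ {x y} → BoundedAway x → x *ℝ y ≈ℝ 0ℝ → y ≈ℝ 0ℝ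
away-cancel {x} {y} (B , 0<B , N₁ , B≤) xy≈0 = small⇒≈0 λ ε 0<ε →
  -- The tolerance `B * ε` becomes `ε` once the lower bound `B` of |x| is cancelled.
  let N₂ , <Bε = ≈0⇒small xy≈0 (B ℚ.* ε)
                   (ℚ.positive⁻¹ (B ℚ.* ε) {{ℚ.pos*pos⇒pos B ε {{ℚ.positive 0<ε}}}})
  in N₁ ℕ.⊔ N₂ , λ n ≤n → ℚ.*-cancelˡ-<-nonNeg B
       (ℚ.≤-<-trans (ℚ.*-monoʳ-≤-nonNeg ∣ seq y n ∣ {{ℚ.∣-∣-nonNeg (seq y n)}} (B≤ n (max₁ ≤n)))
         (≡.subst (ℚ._< B ℚ.* ε) (ℚ.∣p*q∣≡∣p∣*∣q∣ (seq x n) (seq y n)) (<Bε n (max₂ {N₁} ≤n))))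
  where
  instance
    B-pos : ℚ.Positive B
    B-pos = ℚ.positive 0<B
    B-nonNeg : ℚ.NonNegative B
    B-nonNeg = ℚ.pos⇒nonNeg B

∣p∣*∣p∣≡p*p : ∀ p → ∣ p ∣ ℚ.* ∣ p ∣ ≡ p ℚ.* p
∣p∣*∣p∣≡p*p p with ℚ.∣p∣≡p∨∣p∣≡-p p
... | inj₁ eq rewrite eq = ≡.refl
... | inj₂ eq rewrite eq = solve 1 (λ p → :- p :* :- p := p :* p) ≡.refl p
  where open +-*-Solver

0≤p*p : ∀ p → 0ℚ ℚ.≤ p ℚ.* p
0≤p*p p = ≡.subst (0ℚ ℚ.≤_) (≡.trans (ℚ.∣p*q∣≡∣p∣*∣q∣ p p) (∣p∣*∣p∣≡p*p p)) (ℚ.0≤∣p∣ (p ℚ.* p))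

p≤∣p∣ : ∀ p → p ℚ.≤ ∣ p ∣
p≤∣p∣ p with ℚ.≤-total 0ℚ p
... | inj₁ 0≤p = ℚ.≤-reflexive (≡.sym (ℚ.0≤p⇒∣p∣≡p 0≤p))
... | inj₂ p≤0 = ℚ.≤-trans p≤0 (ℚ.0≤∣p∣ p)

away-square : ∀ {x} → BoundedAway x → ∀ y → BoundedAway (x *ℝ x +ℝ y *ℝ y)
away-square {x} (B , 0<B , N , B≤) y =
  B ℚ.* B , ℚ.positive⁻¹ (B ℚ.* B) {{ℚ.pos*pos⇒pos B B}} , N , λ n N≤n → B²≤ (seq x n) (seq y n) (B≤ n N≤n)
  where
  instance
    B-pos : ℚ.Positive B
    B-pos = ℚ.positive 0<B
    B-nonNeg : ℚ.NonNegative B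
    B-nonNeg = ℚ.pos⇒nonNeg B
  B²≤ : ∀ p q → B ℚ.≤ ∣ p ∣ → B ℚ.* B ℚ.≤ ∣ p ℚ.* p ℚ.+ q ℚ.* q ∣
  B²≤ p q B≤p = begin
    B ℚ.* B                     ≤⟨ ℚ.*-monoˡ-≤-nonNeg B B≤p ⟩
    B ℚ.* ∣ p ∣                 ≤⟨ ℚ.*-monoʳ-≤-nonNeg ∣ p ∣ {{ℚ.∣-∣-nonNeg p}} B≤p ⟩
    ∣ p ∣ ℚ.* ∣ p ∣             ≡⟨ ∣p∣*∣p∣≡p*p p ⟩
    p ℚ.* p                     ≡⟨ ℚ.+-identityʳ (p ℚ.* p) ⟨
    p ℚ.* p ℚ.+ 0ℚ              ≤⟨ ℚ.+-monoʳ-≤ (p ℚ.* p) (0≤p*p q) ⟩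
    p ℚ.* p ℚ.+ q ℚ.* q         ≤⟨ p≤∣p∣ (p ℚ.* p ℚ.+ q ℚ.* q) ⟩
    ∣ p ℚ.* p ℚ.+ q ℚ.* q ∣     ∎
    where open ℚ.≤-Reasoning

≈ℂ0-stable : ∀ {z} → Stable (z ≈ℂ 0ℂ)
≈ℂ0-stable ¬¬z≈0 = ≈0-stable (¬¬-map _≈ℂ_.re-≈ ¬¬z≈0) , ≈0-stable (¬¬-map _≈ℂ_.im-≈ ¬¬z≈0)

-- |z|² w = z̄ (z w), so w vanishes with z w once |z|² is bounded away from 0.
norm-cancel : ∀ {z w} → BoundedAway (re z *ℝ re z +ℝ im z *ℝ im z) → z *ℂ w ≈ℂ 0ℂ → w ≈ℂ 0ℂ
norm-cancel {a +i b} {c +i d} away (re≈0 , im≈0) =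
  away-cancel {∣z∣²} away (vanish a b (λ n → re-identity (seq a n) (seq b n) (seq c n) (seq d n)) re≈0 im≈0) ,
  away-cancel {∣z∣²} away (vanish a (-ℝ b) (λ n → im-identity (seq a n) (seq b n) (seq c n) (seq d n)) im≈0 re≈0)
  where
  open +-*-Solver
  ∣z∣² : ℝ
  ∣z∣² = a *ℝ a +ℝ b *ℝ b
  re-identity : ∀ a b c d → (a ℚ.* a ℚ.+ b ℚ.* b) ℚ.* c ≡
    a ℚ.* (a ℚ.* c ℚ.- b ℚ.* d) ℚ.+ b ℚ.* (a ℚ.* d ℚ.+ b ℚ.* c)
  re-identity = solve 4 (λ a b c d → (a :* a :+ b :* b) :* c :=
    a :* (a :* c :- b :* d) :+ b :* (a :* d :+ b :* c)) ≡.refl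
  im-identity : ∀ a b c d → (a ℚ.* a ℚ.+ b ℚ.* b) ℚ.* d ≡
    a ℚ.* (a ℚ.* d ℚ.+ b ℚ.* c) ℚ.+ (ℚ.- b) ℚ.* (a ℚ.* c ℚ.- b ℚ.* d)
  im-identity = solve 4 (λ a b c d → (a :* a :+ b :* b) :* d :=
    a :* (a :* d :+ b :* c) :+ (:- b) :* (a :* c :- b :* d)) ≡.refl
  vanish : ∀ p q {x y r} → (∀ n → seq r n ≡ seq p n ℚ.* seq x n ℚ.+ seq q n ℚ.* seq y n) →
           x ≈ℝ 0ℝ → y ≈ℝ 0ℝ → r ≈ℝ 0ℝ
  vanish p q {x} {y} eq x≈0 y≈0 = ℝR.trans (pointwise {y = p *ℝ x +ℝ q *ℝ y} eq)
    (ℝR.trans (ℝR.+-cong (ℝR.trans (ℝR.*-congˡ x≈0) (ℝR.zeroʳ p))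
                         (ℝR.trans (ℝR.*-congˡ y≈0) (ℝR.zeroʳ q)))
              (ℝR.+-identityˡ 0ℝ))

-- If w were nonzero, |z|² could not be bounded away from 0, hence neither could a coordinate of z;
-- by stability both coordinates would vanish.
ℂ-cancel : ∀ {z w} → ¬ z ≈ℂ 0ℂ → z *ℂ w ≈ℂ 0ℂ → w ≈ℂ 0ℂ
ℂ-cancel {a +i b} {w} z≉0 zw≈0 = ≈ℂ0-stable λ w≉0 →
  let ¬away = λ away → w≉0 (norm-cancel {a +i b} {w} away zw≈0)
  in z≉0 (≈0-stable (λ a≉0 → ≉0⇒¬¬away a≉0 λ away → ¬away (away-square {a} away b)) ,
          ≈0-stable (λ b≉0 → ≉0⇒¬¬away b≉0 λ away → ¬away (away-swap (away-square {b} away a))))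
  where
  away-swap : BoundedAway (b *ℝ b +ℝ a *ℝ a) → BoundedAway (a *ℝ a +ℝ b *ℝ b)
  away-swap (B , 0<B , N , B≤) = B , 0<B , N , λ n N≤n →
    ≡.subst (λ q → B ℚ.≤ ∣ q ∣) (ℚ.+-comm (seq b n ℚ.* seq b n) (seq a n ℚ.* seq a n)) (B≤ n N≤n)

open Mult ℂR.semiring using (×-assoc-*; ×-congʳ) renaming (_×_ to _·_)

-- The multiple `suc n · 1ℂ` has real part at least 1 at every index, so it is a nonzero factor that
-- can be cancelled. This later strips |R| from the averaged sum.
ℂ-torsion-free : ∀ n {z} → suc n · z ≈ℂ 0ℂ → z ≈ℂ 0ℂ
ℂ-torsion-free n {z} nz≈0 = ℂ-cancel {suc n · 1ℂ} {z} n1≉0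
  (ℂR.trans (×-assoc-* (suc n) 1ℂ z) (ℂR.trans (×-congʳ (suc n) (ℂR.*-identityˡ z)) nz≈0))
  where
  0≤ : ∀ n k → 0ℚ ℚ.≤ seq (re (n · 1ℂ)) k
  0≤ zero    k = ℚ.≤-refl
  0≤ (suc n) k = ℚ.+-mono-≤ (ℚ.nonNegative⁻¹ 1ℚ) (0≤ n k)
  n1≉0 : ¬ suc n · 1ℂ ≈ℂ 0ℂ
  n1≉0 (re≈0 , _) = away⇒≉0 {re (suc n · 1ℂ)} (1ℚ , ℚ.positive⁻¹ 1ℚ , 0 , λ k _ →
    ℚ.≤-trans (ℚ.+-monoʳ-≤ 1ℚ (0≤ n k)) (p≤∣p∣ (seq (re (suc n · 1ℂ)) k))) re≈0

-- Finite local rings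

2∤n∧n≢1⇒n∤2 : ∀ {n} → ¬ 2 ℕ.∣ n → ¬ n ≡ 1 → ¬ n ℕ.∣ 2
2∤n∧n≢1⇒n∤2 {n} 2∤n n≢1 n∣2 with n | ℕ.∣⇒≤ n∣2
... | 0 | _ = 2∤n (2 ℕ.∣0)
... | 1 | _ = n≢1 ≡.refl
... | 2 | _ = 2∤n ℕ.∣-refl
... | suc (suc (suc _)) | ℕ.s≤s (ℕ.s≤s ())

module _ (R : CommutativeRing c ℓ) where
  open CommutativeRing R hiding (zero)
  open RingProperties ring using (-1*x≈-x; -0#≈0#; -‿+-comm; -‿involutive)
  open Solver commutativeSemiring using (solve; _:+_; _:*_; _:=_; con)

  -- The ideal I + Rg. With explicit witnesses, membership over a finite ring is decided by search
  -- as soon as membership in I is.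
  adjoin : Ideal R p → Carrier → Ideal R (c ⊔ ℓ ⊔ p)
  adjoin I g = record
    { _∈I      = λ x → ∃[ r ] ∃[ i ] (i ∈ I × x ≈ i + r * g)
    ; ∈-resp-≈ = λ x≈y (r , i , i∈I , x≈) → r , i , i∈I , trans (sym x≈y) x≈
    ; 0∈       = 0# , 0# , 0∈ , sym (trans (+-identityˡ _) (zeroˡ g))
    ; +-closed = λ (r , i , i∈I , x≈) (s , j , j∈I , y≈) → r + s , i + j , +-closed i∈I j∈I ,
        trans (+-cong x≈ y≈)
          (solve 5 (λ i r j s g → (i :+ r :* g) :+ (j :+ s :* g) := (i :+ j) :+ (r :+ s) :* g)
            refl i r j s g)
    ; *-closed = λ t (r , i , i∈I , x≈) → t * r , t * i , *-closed t i∈I ,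
        trans (*-congˡ x≈)
          (solve 4 (λ t i r g → t :* (i :+ r :* g) := t :* i :+ t :* r :* g) refl t i r g)
    }
    where open Ideal I

  principal : Carrier → Ideal R (c ⊔ ℓ)
  principal = adjoin (zeroIdeal R)

  ∈principal⇒multiple : ∀ {g x} → x ∈ principal g → ∃[ r ] x ≈ r * g
  ∈principal⇒multiple (r , i , i≈0 , x≈) = r , trans x≈ (trans (+-congʳ i≈0) (+-identityˡ _))

  multiple∈principal : ∀ {g} r → r * g ∈ principal g
  multiple∈principal r = r , 0# , refl , sym (+-identityˡ _)

  ⊆adjoin : ∀ (I : Ideal R p) g → I ⊆ adjoin I g
  ⊆adjoin I g {x} x∈I = 0# , x , x∈I , sym (trans (+-congˡ (zeroˡ g)) (+-identityʳ x))

  adjoin⊆ : ∀ {q} (I : Ideal R p) (J : Ideal R q) {g} → I ⊆ J → g ∈ J → adjoin I g ⊆ J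
  adjoin⊆ I J I⊆J g∈J (r , i , i∈I , x≈) =
    ∈-resp-≈ (sym x≈) (+-closed (I⊆J i∈I) (*-closed r g∈J))
    where open Ideal J

  -‿closed : ∀ (I : Ideal R p) {x} → x ∈ I → - x ∈ I
  -‿closed I {x} x∈I = ∈-resp-≈ (-1*x≈-x x) (*-closed (- 1#) x∈I)
    where open Ideal I

  1∈⇒whole : ∀ (I : Ideal R p) → 1# ∈ I → IsWhole R I
  1∈⇒whole I 1∈I x = ∈-resp-≈ (*-identityʳ x) (*-closed x 1∈I)
    where open Ideal I

  unit*≉0 : ∀ {x u} → IsUnit R u → ¬ x ≈ 0# → ¬ x * u ≈ 0#
  unit*≉0 {x} {u} (u⁻¹ , _ , uu⁻¹) x≉0 xu≈0 = x≉0 (begin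
    x             ≈⟨ *-identityʳ x ⟨
    x * 1#        ≈⟨ *-congˡ uu⁻¹ ⟨
    x * (u * u⁻¹) ≈⟨ *-assoc x u u⁻¹ ⟨
    x * u * u⁻¹   ≈⟨ *-congʳ xu≈0 ⟩
    0# * u⁻¹      ≈⟨ zeroˡ u⁻¹ ⟩
    0#            ∎)
    where open ≈-Reasoning setoid

  IsUnit-resp-≈ : ∀ {x y} → x ≈ y → IsUnit R x → IsUnit R y
  IsUnit-resp-≈ x≈y (x⁻¹ , x⁻¹x , xx⁻¹) =
    x⁻¹ , trans (*-congˡ (sym x≈y)) x⁻¹x , trans (*-congʳ (sym x≈y)) xx⁻¹

  module _ (finite : IsFinite R) where
    open Inverse (proj₂ finite) using ()
      renaming (to to element; from to index; strictlyInverseˡ to element-index)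

    private
      size : ℕ
      size = proj₁ finite

    ∃? : ∀ {P : Pred Carrier p} → (∀ {x y} → x ≈ y → P x → P y) → Decidable P → Dec (∃[ x ] P x)
    ∃? P-resp P? = Dec.map′ (λ (i , Pi) → element i , Pi)
      (λ (x , Px) → index x , P-resp (sym (element-index x)) Px)
      (Fin.any? (P? ∘ element))

    adjoin? : ∀ (I : Ideal R p) → Decidable (_∈ I) → ∀ g → Decidable (_∈ adjoin I g)
    adjoin? I I? g x =
      ∃? (λ r≈s (i , i∈I , x≈) → i , i∈I , trans x≈ (+-congˡ (*-congʳ r≈s))) λ r →
      ∃? (λ i≈j (i∈I , x≈) → ∈-resp-≈ i≈j i∈I , trans x≈ (+-congʳ i≈j)) λ i →
      I? i Dec.×-dec _≟_ R finite x (i + r * g)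
      where open Ideal I

    -- Existence of maximal ideals in a finite ring

    Comaximal : Ideal R (c ⊔ ℓ) → Carrier → Set (c ⊔ ℓ)
    Comaximal I x = 1# ∈ adjoin I x

    -- Greedy extension: each element is adjoined if the ideal stays proper. A rejected element is
    -- comaximal with the current ideal, hence with every larger one, so no decision has to be
    -- revised.
    saturate : ∀ {m} (f : Fin m → Carrier) (I : Ideal R (c ⊔ ℓ)) → Decidable (_∈ I) → ¬ 1# ∈ I →
               ∃[ J ] ¬ 1# ∈ J × I ⊆ J × (∀ i → f i ∈ J ⊎ Comaximal J (f i))
    saturate {zero}  f I I? 1∉I = I , 1∉I , (λ x∈I → x∈I) , λ ()
    saturate {suc m} f I I? 1∉I with adjoin? I I? (f zero) 1#
    ... | yes comax =
      let J , 1∉J , I⊆J , settled = saturate (f ∘ suc) I I? 1∉I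
      in J , 1∉J , I⊆J , λ where
           zero    → inj₂ (adjoin⊆ I (adjoin J (f zero)) (⊆adjoin J (f zero) ∘ I⊆J) (g∈ J) comax)
           (suc i) → settled i
      where
      g∈ : ∀ (J : Ideal R (c ⊔ ℓ)) → f zero ∈ adjoin J (f zero)
      g∈ J = 1# , 0# , Ideal.0∈ J , sym (trans (+-identityˡ _) (*-identityˡ (f zero)))
    ... | no ¬comax =
      let J , 1∉J , I+g⊆J , settled = saturate (f ∘ suc) (adjoin I (f zero)) (adjoin? I I? (f zero)) ¬comax
      in J , 1∉J , I+g⊆J ∘ ⊆adjoin I (f zero) , λ where
           zero    → inj₁ (I+g⊆J (1# , 0# , Ideal.0∈ I ,
                       sym (trans (+-identityˡ _) (*-identityˡ (f zero)))))
           (suc i) → settled i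

    -- A finite form of Zorn's lemma: once `saturate` has treated every element, each is in J or
    -- comaximal with J, and a proper K above J contains none of the latter.
    maximalAbove : ∀ (I : Ideal R (c ⊔ ℓ)) → Decidable (_∈ I) → ¬ 1# ∈ I → ∃[ J ] IsMaximal R J × I ⊆ J
    maximalAbove I I? 1∉I =
      let J , 1∉J , I⊆J , settled = saturate element I I? 1∉I
      in J , ((λ whole → 1∉J (whole 1#)) , maximal J settled) , I⊆J
      where
      maximal : ∀ J → (∀ i → element i ∈ J ⊎ Comaximal J (element i)) →
                ∀ (K : Ideal R (c ⊔ ℓ)) → ¬ IsWhole R K → J ⊆ K → K ⊆ J
      maximal J settled K K≠R J⊆K {x} x∈K with settled (index x)
      ... | inj₁ x′∈J  = Ideal.∈-resp-≈ J (element-index x) x′∈J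
      ... | inj₂ comax = contradiction
        (1∈⇒whole K (adjoin⊆ J K J⊆K (Ideal.∈-resp-≈ K (sym (element-index x)) x∈K) comax)) K≠R

    -- Units, nilpotence and the socle of a finite local ring

    module _ (local : IsLocal R) where
      open IsLocal local
      open Ideal M

      1∉M : ¬ 1# ∈ M
      1∉M = proj₁ M-maximal ∘ 1∈⇒whole M

      ∈M⇒nonunit : ∀ {x} → x ∈ M → ¬ IsUnit R x
      ∈M⇒nonunit x∈M (x⁻¹ , x⁻¹x , _) = 1∉M (∈-resp-≈ x⁻¹x (*-closed x⁻¹ x∈M))

      -- A nonunit generates a proper ideal, and the maximal ideal above it can only be M.
      nonunit⇒∈M : ∀ {x} → ¬ IsUnit R x → x ∈ M
      nonunit⇒∈M {x} ¬unit =
        let J , J-maximal , xR⊆J = maximalAbove (principal x)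
              (adjoin? (zeroIdeal R) (λ y → _≟_ R finite y 0#) x) 1∉xR
        in proj₁ (M-unique J J-maximal)
             (xR⊆J (Ideal.∈-resp-≈ (principal x) (*-identityˡ x) (multiple∈principal 1#)))
        where
        1∉xR : ¬ 1# ∈ principal x
        1∉xR 1∈xR with r , 1≈rx ← ∈principal⇒multiple 1∈xR =
          ¬unit (r , sym 1≈rx , trans (*-comm x r) (sym 1≈rx))

      unit+M : ∀ {u m} → IsUnit R u → m ∈ M → IsUnit R (u + m)
      unit+M {u} {m} unit m∈M with isUnit? R finite (u + m)
      ... | yes unit′ = unit′
      ... | no ¬unit′ = contradiction unit
        (∈M⇒nonunit (∈-resp-≈ u+m-m≈u (+-closed (nonunit⇒∈M ¬unit′) (-‿closed M m∈M))))
        where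
        u+m-m≈u : u + m + - m ≈ u
        u+m-m≈u = trans (+-assoc u m (- m)) (trans (+-congˡ (-‿inverseʳ m)) (+-identityʳ u))

      isUnit-1 : IsUnit R 1#
      isUnit-1 = 1# , *-identityˡ 1# , *-identityˡ 1#

      -- Nakayama's lemma for one element: t(1 - q) = 0 and 1 - q is a unit.
      absorbs⇒≈0 : ∀ {t q} → q ∈ M → t ≈ t * q → t ≈ 0#
      absorbs⇒≈0 {t} {q} q∈M t≈tq = decidable-stable (_≟_ R finite t 0#) λ t≉0 →
        unit*≉0 (unit+M isUnit-1 (-‿closed M q∈M)) t≉0 (begin
          t * (1# + - q)   ≈⟨ distribˡ t 1# (- q) ⟩
          t * 1# + t * - q ≈⟨ +-congʳ (*-identityʳ t) ⟩
          t + t * - q      ≈⟨ +-congʳ t≈tq ⟩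
          t * q + t * - q  ≈⟨ distribˡ t q (- q) ⟨
          t * (q + - q)    ≈⟨ *-congˡ (-‿inverseʳ q) ⟩
          t * 0#           ≈⟨ zeroʳ t ⟩
          0#               ∎)
        where open ≈-Reasoning setoid

      open Exp semiring using (_^_; ^-homo-*)

      -- Among the `suc size` powers with exponents 0 to `size` two coincide. The lower one then
      -- absorbs a positive power of m, which lies in M, and so vanishes.
      nilpotent : ∀ {m} → m ∈ M → ∃[ k ] m ^ k ≈ 0#
      nilpotent {m} m∈M
        with i , j , i<j , eq ← Fin.pigeonhole (ℕ.n<1+n size) (λ (k : Fin (suc size)) → index (m ^ toℕ k))
        with d , 1+i+d≡j ← ℕ.m≤n⇒∃[o]m+o≡n i<j =
        toℕ i , absorbs⇒≈0 (∈-resp-≈ (*-comm _ m) (*-closed (m ^ d) m∈M)) (begin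
          m ^ toℕ i                 ≈⟨ index-injective eq ⟩
          m ^ toℕ j                 ≡⟨ ≡.cong (m ^_) (≡.trans (≡.sym 1+i+d≡j) (≡.sym (ℕ.+-suc (toℕ i) d))) ⟩
          m ^ (toℕ i ℕ.+ suc d)     ≈⟨ ^-homo-* m (toℕ i) (suc d) ⟩
          m ^ toℕ i * (m * m ^ d)   ∎)
        where
        open ≈-Reasoning setoid
        index-injective : ∀ {x y} → index x ≡ index y → x ≈ y
        index-injective {x} {y} eq = trans (sym (element-index x))
          (trans (reflexive (≡.cong element eq)) (element-index y))

      -- The witness r is the last power of m that does not kill y.
      lastPower : ∀ {m} k y → ¬ y ≈ 0# → y * m ^ k ≈ 0# → ∃[ r ] (¬ y * r ≈ 0#) × y * r * m ≈ 0#
      lastPower     zero    y y≉0 y1≈0  = contradiction (trans (sym (*-identityʳ y)) y1≈0) y≉0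
      lastPower {m} (suc k) y y≉0 ymᵏ≈0 with _≟_ R finite (y * m) 0#
      ... | yes ym≈0 = 1# , (λ y1≈0 → y≉0 (trans (sym (*-identityʳ y)) y1≈0)) ,
                       trans (*-congʳ (*-identityʳ y)) ym≈0
      ... | no  ym≉0 =
        let r , ymr≉0 , ymrm≈0 = lastPower k (y * m) ym≉0 (trans (*-assoc y m (m ^ k)) ymᵏ≈0)
        in m * r , (λ ymr≈0 → ymr≉0 (trans (*-assoc y m r) ymr≈0)) ,
           trans (*-congʳ (sym (*-assoc y m r))) ymrm≈0

      -- The multiplier is built up one element at a time; a product already killed by `f zero`
      -- remains so after further multiplication. Units are skipped, as they lie outside M.
      annihilateAll : ∀ {n} (f : Fin n → Carrier) y → ¬ y ≈ 0# →
                      ∃[ r ] (¬ y * r ≈ 0#) × (∀ i → f i ∈ M → y * r * f i ≈ 0#)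
      annihilateAll {zero}  f y y≉0 = 1# , (λ y1≈0 → y≉0 (trans (sym (*-identityʳ y)) y1≈0)) , λ ()
      annihilateAll {suc n} f y y≉0 with isUnit? R finite (f zero)
      ... | yes unit =
        let r , yr≉0 , kills = annihilateAll (f ∘ suc) y y≉0
        in r , yr≉0 , λ where
             zero    f₀∈M → contradiction unit (∈M⇒nonunit f₀∈M)
             (suc i) fᵢ∈M → kills i fᵢ∈M
      ... | no ¬unit =
        let k , f₀ᵏ≈0 = nilpotent (nonunit⇒∈M ¬unit)
            q , yq≉0 , yqf₀≈0 = lastPower k y y≉0 (trans (*-congˡ f₀ᵏ≈0) (zeroʳ y))
            r , yqr≉0 , kills = annihilateAll (f ∘ suc) (y * q) yq≉0
        in q * r , (λ yqr≈0 → yqr≉0 (trans (*-assoc y q r) yqr≈0)) , λ where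
             zero    _    → trans (solve 4 (λ y q r x → y :* (q :* r) :* x := y :* q :* x :* r) refl y q r (f zero))
                              (trans (*-congʳ yqf₀≈0) (zeroˡ r))
             (suc i) fᵢ∈M → trans (*-congʳ (sym (*-assoc y q r))) (kills i fᵢ∈M)

      -- Running through all elements of M shows that every nonzero principal ideal meets the socle,
      -- the annihilator of M. The form `y * r` keeps the result inside any ideal containing y.
      socleMultiple : ∀ y → ¬ y ≈ 0# → ∃[ r ] (¬ y * r ≈ 0#) × (∀ {m} → m ∈ M → y * r * m ≈ 0#)
      socleMultiple y y≉0 =
        let r , yr≉0 , kills = annihilateAll element y y≉0
        in r , yr≉0 , λ {m} m∈M → trans (*-congˡ (sym (element-index m)))
             (kills (index m) (∈-resp-≈ (sym (element-index m)) m∈M))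

      -- Square roots in 1 + M

      -- Newton's step: if 2uh = 1 and the error is t = mᵏr, then u + th has error -(th)².
      approximateSqrt : IsUnit R (1# + 1#) → ∀ {m} → m ∈ M → ∀ k →
                        ∃[ u ] IsUnit R u × ∃[ r ] 1# + m ≈ u * u + m ^ suc k * r
      approximateSqrt _ {m} _ zero = 1# , isUnit-1 , 1# ,
        solve 1 (λ m → con 1 :+ m := con 1 :* con 1 :+ m :* con 1 :* con 1) refl m
      approximateSqrt two@(½ , ½2≈1 , _) {m} m∈M (suc k)
        with u , u-unit@(u⁻¹ , u⁻¹u≈1 , _) , r , 1+m≈ ← approximateSqrt two m∈M k =
        u + t * h , unit+M u-unit th∈M , - e , (begin
          1# + m
            ≈⟨ 1+m≈ ⟩
          u * u + t
            ≈⟨ +-congˡ (*-identityʳ t) ⟨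
          u * u + t * 1#
            ≈⟨ +-congˡ (*-congˡ h2u≈1) ⟨
          u * u + t * (h * (u + u))
            -- Zero enters as m^(k+2) (e - e): `e` completes the square and `- e` is left over as an
            -- independent variable of the semiring identity.
            ≈⟨ +-identityʳ _ ⟨
          u * u + t * (h * (u + u)) + 0#
            ≈⟨ +-congˡ (zeroʳ _) ⟨
          u * u + t * (h * (u + u)) + m * (m * m ^ k) * 0#
            ≈⟨ +-congˡ (*-congˡ (-‿inverseʳ e)) ⟨
          u * u + t * (h * (u + u)) + m * (m * m ^ k) * (e + - e)
            ≈⟨ solve 6 (λ u h m P r n →
                 u :* u :+ m :* P :* r :* (h :* (u :+ u)) :+ m :* (m :* P) :* (P :* r :* r :* h :* h :+ n) :=
                 (u :+ m :* P :* r :* h) :* (u :+ m :* P :* r :* h) :+ m :* (m :* P) :* n)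
                 refl u h m (m ^ k) r (- e) ⟩
          (u + t * h) * (u + t * h) + m * (m * m ^ k) * - e ∎)
        where
        open ≈-Reasoning setoid
        t h e : Carrier
        t = m * m ^ k * r
        h = ½ * u⁻¹
        -- Chosen so that (th)² = m^(k+2) e. Of the factor m^(2k+2) only m^(k+2) is split off;
        -- gaining one power of m per step suffices.
        e = m ^ k * r * r * h * h
        th∈M : t * h ∈ M
        th∈M = ∈-resp-≈ (solve 4 (λ m P r h → (P :* r :* h) :* m := m :* P :* r :* h) refl m (m ^ k) r h)
          (*-closed (m ^ k * r * h) m∈M)
        h2u≈1 : h * (u + u) ≈ 1#
        h2u≈1 = begin
          h * (u + u)               ≈⟨ solve 3 (λ ½ u⁻¹ u → ½ :* u⁻¹ :* (u :+ u) :=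
                                         ½ :* (con 1 :+ con 1) :* (u⁻¹ :* u)) refl ½ u⁻¹ u ⟩
          ½ * (1# + 1#) * (u⁻¹ * u) ≈⟨ *-cong ½2≈1 u⁻¹u≈1 ⟩
          1# * 1#                   ≈⟨ *-identityˡ 1# ⟩
          1#                        ∎

      -- Once m^k = 0 the remainder m^(k+1) r of the approximation vanishes.
      1+M-square : IsUnit R (1# + 1#) → ∀ {m} → m ∈ M → ∃[ u ] IsUnit R u × 1# + m ≈ u * u
      1+M-square two m∈M =
        let k , mᵏ≈0 = nilpotent m∈M
            u , u-unit , r , 1+m≈ = approximateSqrt two m∈M k
        in u , u-unit , trans 1+m≈ (trans
             (+-congˡ (trans (*-congʳ (trans (*-congˡ mᵏ≈0) (zeroʳ _))) (zeroˡ r))) (+-identityʳ _))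

      -- If 2 were a nonunit it would vanish in R/M, so the characteristic q would divide 2. But q
      -- is odd, and q = 1 would put 1 into M.
      odd⇒2-unit : HasOddCharacteristic R local → IsUnit R (1# + 1#)
      odd⇒2-unit (q , char , 2∤q) with isUnit? R finite (1# + 1#)
      ... | yes unit = unit
      ... | no ¬unit = contradiction
        (Equivalence.to (char 2) (∈-resp-≈ 2≈ (nonunit⇒∈M ¬unit))) (2∤n∧n≢1⇒n∤2 2∤q q≢1)
        where
        -- In the quotient, x ≈ 0 unfolds to x - 0 ∈ M, and the multiple 2·1 unfolds to 1 + (1 + 0).
        x-0≈x : ∀ {x} → x ≈ x + - 0#
        x-0≈x {x} = sym (trans (+-congˡ -0#≈0#) (+-identityʳ x))
        2≈ : 1# + 1# ≈ 1# + (1# + 0#) + - 0#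
        2≈ = trans (+-congˡ (sym (+-identityʳ 1#))) x-0≈x
        q≢1 : ¬ q ≡ 1
        q≢1 ≡.refl = 1∉M (∈-resp-≈ (trans (sym x-0≈x) (+-identityʳ 1#)) (Equivalence.from (char 1) ℕ.∣-refl))

      -- a = u(u - t) = u²(1 - t u⁻¹) for t = u - a u⁻¹.
      ∈M⇒square : IsUnit R (1# + 1#) → ∀ {a u u⁻¹} → u⁻¹ * u ≈ 1# → u * u⁻¹ ≈ 1# →
                  u + - (a * u⁻¹) ∈ M → IsSquareOfUnit R a
      ∈M⇒square two {a} {u} {u⁻¹} u⁻¹u≈1 uu⁻¹≈1 t∈M =
        let v , v-unit , 1-tu⁻¹≈vv = 1+M-square two -tu⁻¹∈M
        in (v , v-unit) ∙ (u , u⁻¹ , u⁻¹u≈1 , uu⁻¹≈1) , (begin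
          a                                ≈⟨ *-identityʳ a ⟨
          a * 1#                           ≈⟨ *-congˡ u⁻¹u≈1 ⟨
          a * (u⁻¹ * u)                    ≈⟨ *-assoc a u⁻¹ u ⟨
          b * u                            ≈⟨ *-congʳ u-t≈b ⟨
          (u + - t) * u                    ≈⟨ *-congʳ (+-congˡ (trans (*-congˡ u⁻¹u≈1) (*-identityʳ (- t)))) ⟨
          (u + - t * (u⁻¹ * u)) * u        ≈⟨ solve 3 (λ u u⁻¹ n → (u :+ n :* (u⁻¹ :* u)) :* u :=
                                                (con 1 :+ u⁻¹ :* n) :* (u :* u)) refl u u⁻¹ (- t) ⟩
          (1# + u⁻¹ * - t) * (u * u)       ≈⟨ *-congʳ 1-tu⁻¹≈vv ⟩
          v * v * (u * u)                  ≈⟨ solve 2 (λ v u → v :* v :* (u :* u) := v :* u :* (v :* u)) refl v u ⟩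
          v * u * (v * u)                  ∎)
        where
        open ≈-Reasoning setoid
        open AbelianGroup (unitGroup R) using (_∙_)
        b t : Carrier
        b = a * u⁻¹
        t = u + - b
        -tu⁻¹∈M : u⁻¹ * - t ∈ M
        -tu⁻¹∈M = *-closed u⁻¹ (-‿closed M t∈M)
        u-t≈b : u + - t ≈ b
        u-t≈b = begin
          u + - (u + - b)      ≈⟨ +-congˡ (-‿+-comm u (- b)) ⟨
          u + (- u + - - b)    ≈⟨ +-assoc u (- u) (- - b) ⟨
          u + - u + - - b      ≈⟨ +-cong (-‿inverseʳ u) (-‿involutive b) ⟩
          0# + b               ≈⟨ +-identityˡ b ⟩
          b                    ∎

-- Character sums

open Character using (value)
open Sum ℂR.semiring using (sum; sum-cong-≋; sum-permute; sum-replicate; sum-replicate-zero; ∑-comm; *-distribˡ-sum)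

module CharacterProperties {g ℓ} {G : AbelianGroup g ℓ} (χ : Character G) where
  open AbelianGroup G
  open GroupMorphisms.IsGroupHomomorphism (Character.isHomomorphism χ)

  value-cong : ∀ {x y} → x ≈ y → value χ x ≈ℂ value χ y
  value-cong = ⟦⟧-cong

  value-∙ : ∀ x y → value χ (x ∙ y) ≈ℂ value χ x *ℂ value χ y
  value-∙ = homo

  value-ε : value χ ε ≈ℂ 1ℂ
  value-ε = ε-homo

-- Summation over the ring and over its units

module _ (R : CommutativeRing c ℓ) (finite : IsFinite R) where
  open CommutativeRing R hiding (zero)
  open RingProperties ring using (-‿distribˡ-*; -‿distribʳ-*; -0#≈0#)
  open Solver commutativeSemiring using (solve; _:+_; _:*_; _:=_; con)
  open Inverse (proj₂ finite) using ()
    renaming (to to element; from to index; strictlyInverseˡ to element-index)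

  private
    size : ℕ
    size = proj₁ finite

  Σᴿ : (Carrier → ℂ) → ℂ
  Σᴿ f = sum λ i → f (element i)

  -- Conjugating π by the enumeration gives a permutation of indices; `f-cong` absorbs the round
  -- trip through `index`.
  reindex : (π : Inverse setoid setoid) (f : Carrier → ℂ) → (∀ {x y} → x ≈ y → f x ≈ℂ f y) →
            Σᴿ f ≈ℂ Σᴿ (f ∘ Inverse.to π)
  reindex π f f-cong = ℂR.trans
    (sum-permute (f ∘ element)
      (InverseProperties.trans (proj₂ finite) (InverseProperties.trans π (InverseProperties.sym (proj₂ finite)))))
    (sum-cong-≋ λ i → f-cong (element-index (Inverse.to π (element i))))

  translation : Carrier → Inverse setoid setoid
  translation y = record
    { to = y +_
    ; from = - y +_
    ; to-cong = +-congˡ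
    ; from-cong = +-congˡ
    ; inverse = (λ {x} z≈ → trans (+-congˡ z≈) (cancel (-‿inverseʳ y) x))
              , (λ {x} z≈ → trans (+-congˡ z≈) (cancel (-‿inverseˡ y) x))
    }
    where
    cancel : ∀ {p q} → p + q ≈ 0# → ∀ x → p + (q + x) ≈ x
    cancel p+q≈0 x = trans (sym (+-assoc _ _ x)) (trans (+-congʳ p+q≈0) (+-identityˡ x))

  dilation : Units R → Inverse setoid setoid
  dilation (u , u⁻¹ , u⁻¹u≈1 , uu⁻¹≈1) = record
    { to = _* u
    ; from = _* u⁻¹
    ; to-cong = *-congʳ
    ; from-cong = *-congʳ
    ; inverse = (λ {x} z≈ → trans (*-congʳ z≈) (cancel u⁻¹u≈1 x))
              , (λ {x} z≈ → trans (*-congʳ z≈) (cancel uu⁻¹≈1 x))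
    }
    where
    cancel : ∀ {p q} → p * q ≈ 1# → ∀ x → x * p * q ≈ x
    cancel pq≈1 x = trans (*-assoc x _ _) (trans (*-congˡ pq≈1) (*-identityʳ x))

  module _ (F : Units R → ℂ) (F-cong : ∀ {u v} → proj₁ u ≈ proj₁ v → F u ≈ℂ F v) where

    -- The inverse found by `isUnit?` may differ from the one stored in u; `F-cong` makes the value
    -- independent of it.
    extendByZero-unit : ∀ u {x} → x ≈ proj₁ u → extendByZero R finite F x ≈ℂ F u
    extendByZero-unit (u , inverses) {x} x≈u with isUnit? R finite x
    ... | yes _     = F-cong x≈u
    ... | no ¬unit  = contradiction (IsUnit-resp-≈ R (sym x≈u) inverses) ¬unit

    extendByZero-nonunit : ∀ {x} → ¬ IsUnit R x → extendByZero R finite F x ≈ℂ 0ℂ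
    extendByZero-nonunit {x} ¬unit with isUnit? R finite x
    ... | yes unit = contradiction unit ¬unit
    ... | no _     = ℂR.refl

    extendByZero-cong : ∀ {x y} → x ≈ y → extendByZero R finite F x ≈ℂ extendByZero R finite F y
    extendByZero-cong {x} {y} x≈y with isUnit? R finite y
    ... | yes unit  = extendByZero-unit (y , unit) x≈y
    ... | no ¬unit  = extendByZero-nonunit (¬unit ∘ IsUnit-resp-≈ R x≈y)

  -- Orthogonality for additive characters

  module _ (ψ : AdditiveCharacter R) where
    open CharacterProperties ψ

    -- Translating by y multiplies the sum S by ψ(vy), so S ≠ 0 would force ψ = 1 on vR.
    sum-additive≈0 : ∀ v → ¬ (∀ y → value ψ (v * y) ≈ℂ 1ℂ) → Σᴿ (λ y → value ψ (v * y)) ≈ℂ 0ℂ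
    sum-additive≈0 v nontrivial = ≈ℂ0-stable λ S≉0 → nontrivial (ψ-trivial S≉0)
      where
      f : Carrier → ℂ
      f y = value ψ (v * y)
      S : ℂ
      S = Σᴿ f
      S≈fyS : ∀ y → S ≈ℂ f y *ℂ S
      S≈fyS y = begin
        Σᴿ f                       ≈⟨ reindex (translation y) f (λ x≈y → value-cong (*-congˡ x≈y)) ⟩
        Σᴿ (λ x → f (y + x))       ≈⟨ sum-cong-≋ (λ i → ℂR.trans (value-cong (distribˡ v y (element i)))
                                        (value-∙ (v * y) (v * element i))) ⟩
        Σᴿ (λ x → f y *ℂ f x)      ≈⟨ *-distribˡ-sum (f y) (f ∘ element) ⟨
        f y *ℂ S                   ∎
        where open ℂ≈
      ψ-trivial : ¬ S ≈ℂ 0ℂ → ∀ y → f y ≈ℂ 1ℂ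
      ψ-trivial S≉0 y = x∙y⁻¹≈ε⇒x≈y (f y) 1ℂ (ℂ-cancel {S} {f y ℂR.- 1ℂ} S≉0 (begin
        S *ℂ (f y ℂR.- 1ℂ)         ≈⟨ x[y-z]≈xy-xz S (f y) 1ℂ ⟩
        S *ℂ f y ℂR.- S *ℂ 1ℂ      ≈⟨ ℂR.+-cong (ℂR.trans (ℂR.*-comm S (f y)) (ℂR.sym (S≈fyS y)))
                                        (ℂR.-‿cong (ℂR.*-identityʳ S)) ⟩
        S ℂR.- S                   ≈⟨ ℂR.-‿inverseʳ S ⟩
        0ℂ                         ∎))
        where
        open ℂ≈
        open RingProperties ℂR.ring using (x∙y⁻¹≈ε⇒x≈y; x[y-z]≈xy-xz)

    -- Otherwise ψ would be 1 on the ideal vR, which contains v.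
    primitive⇒nontrivial : IsPrimitiveAdditive R ψ → ∀ {v} → ¬ v ≈ 0# →
                           ¬ (∀ y → value ψ (v * y) ≈ℂ 1ℂ)
    primitive⇒nontrivial ψ-primitive {v} v≉0 trivial = v≉0 (ψ-primitive (principal R v)
      (λ x x∈vR → let r , x≈rv = ∈principal⇒multiple R x∈vR
                  in ℂR.trans (value-cong (trans x≈rv (*-comm r v))) (trivial r))
      (Ideal.∈-resp-≈ (principal R v) (*-identityˡ v) (multiple∈principal R 1#)))

    -- Averaging the Kloosterman sum over 1 + sR

    module _ (τ : MultiplicativeCharacter R) (a : Carrier) where
      private
        module τ = CharacterProperties τ
        open AbelianGroup (unitGroup R) using (_∙_; ⁻¹-cong)

      summand : Units R → ℂ
      summand u@(x , x⁻¹ , _) = value τ u *ℂ value ψ (x + a * x⁻¹)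

      summand-cong : ∀ {u v} → proj₁ u ≈ proj₁ v → summand u ≈ℂ summand v
      summand-cong {u} {v} u≈v =
        ℂR.*-cong (τ.value-cong {u} {v} u≈v) (value-cong (+-cong u≈v (*-congˡ (⁻¹-cong {u} {v} u≈v))))

      -- The logarithmic derivative of u + au⁻¹ with respect to u.
      defect : Units R → Carrier
      defect (x , x⁻¹ , _) = x + - (a * x⁻¹)

      -- Since s² = 0, the inverse of 1 + sy is 1 - sy; hence replacing u by u(1 + sy)
      -- changes u + au⁻¹ by sy(u - au⁻¹).
      module _ {s} (s*s≈0 : s * s ≈ 0#) where

        1+_ : Carrier → Units R
        1+ y = 1# + s * y , 1# + - (s * y) ,
               trans (*-comm _ _) (mutually-inverse (s * y) (- (s * y)) (-‿inverseʳ _) pq≈0) ,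
               mutually-inverse (s * y) (- (s * y)) (-‿inverseʳ _) pq≈0
          where
          mutually-inverse : ∀ p q → p + q ≈ 0# → p * q ≈ 0# → (1# + p) * (1# + q) ≈ 1#
          mutually-inverse p q p+q≈0 pq≈0 = begin
            (1# + p) * (1# + q)     ≈⟨ solve 2 (λ p q → (con 1 :+ p) :* (con 1 :+ q) :=
                                         con 1 :+ (p :+ q) :+ p :* q) refl p q ⟩
            1# + (p + q) + p * q    ≈⟨ +-cong (+-congˡ p+q≈0) pq≈0 ⟩
            1# + 0# + 0#            ≈⟨ trans (+-identityʳ _) (+-identityʳ 1#) ⟩
            1#                      ∎
            where open ≈-Reasoning setoid
          pq≈0 : s * y * - (s * y) ≈ 0#
          pq≈0 = begin
            s * y * - (s * y)       ≈⟨ -‿distribʳ-* (s * y) (s * y) ⟨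
            - (s * y * (s * y))     ≈⟨ -‿cong (solve 2 (λ s y → s :* y :* (s :* y) := s :* s :* (y :* y)) refl s y) ⟩
            - (s * s * (y * y))     ≈⟨ -‿cong (trans (*-congʳ s*s≈0) (zeroˡ _)) ⟩
            - 0#                    ≈⟨ -0#≈0# ⟩
            0#                      ∎
            where open ≈-Reasoning setoid

        argument-shift : ∀ x x⁻¹ y →
          x * (1# + s * y) + a * ((1# + - (s * y)) * x⁻¹) ≈ (x + a * x⁻¹) + s * (x + - (a * x⁻¹)) * y
        argument-shift x x⁻¹ y = begin
          x * (1# + sy) + a * ((1# + - sy) * x⁻¹)
            ≈⟨ solve 5 (λ x x⁻¹ a p q → x :* (con 1 :+ p) :+ a :* ((con 1 :+ q) :* x⁻¹) :=
                 (x :+ a :* x⁻¹) :+ (p :* x :+ q :* (a :* x⁻¹))) refl x x⁻¹ a sy (- sy) ⟩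
          (x + a * x⁻¹) + (sy * x + - sy * (a * x⁻¹))
            ≈⟨ +-congˡ (+-congˡ (trans (sym (-‿distribˡ-* sy _)) (-‿distribʳ-* sy _))) ⟩
          (x + a * x⁻¹) + (sy * x + sy * - (a * x⁻¹))
            ≈⟨ +-congˡ (solve 4 (λ s y x n → s :* y :* x :+ s :* y :* n := s :* (x :+ n) :* y)
                 refl s y x (- (a * x⁻¹))) ⟩
          (x + a * x⁻¹) + s * (x + - (a * x⁻¹)) * y ∎
          where
          open ≈-Reasoning setoid
          sy : Carrier
          sy = s * y

        summand-shift : (∀ y u → proj₁ u ≈ 1# + s * y → value τ u ≈ℂ 1ℂ) →
                        ∀ u y → summand (u ∙ 1+ y) ≈ℂ summand u *ℂ value ψ (s * defect u * y)
        summand-shift τ-trivial u@(x , x⁻¹ , _) y = begin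
          value τ (u ∙ 1+ y) *ℂ value ψ (x * (1# + s * y) + a * ((1# + - (s * y)) * x⁻¹))
            ≈⟨ ℂR.*-cong (ℂR.trans (τ.value-∙ u (1+ y)) (ℂR.trans (ℂR.*-congˡ (τ-trivial y (1+ y) refl)) (ℂR.*-identityʳ _)))
                 (ℂR.trans (value-cong (argument-shift x x⁻¹ y)) (value-∙ _ _)) ⟩
          value τ u *ℂ (value ψ (x + a * x⁻¹) *ℂ value ψ (s * defect u * y))
            ≈⟨ ℂR.*-assoc _ _ _ ⟨
          summand u *ℂ value ψ (s * defect u * y) ∎
          where open ℂ≈

        -- Multiplication by 1 + sy permutes all of R, so K can be reindexed in the sum over the
        -- enumeration. After the exchange of sums, units give an additive character sum and
        -- nonunits give 0.
        averaging : (∀ y u → proj₁ u ≈ 1# + s * y → value τ u ≈ℂ 1ℂ) →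
                    (∀ u → ¬ (∀ y → value ψ (s * defect u * y) ≈ℂ 1ℂ)) →
                    kloosterman R finite ψ τ a ≈ℂ 0ℂ
        averaging τ-trivial nontrivial = n·K≈0⇒K≈0 (proj₂ finite) (begin
          sum {size} (λ _ → K)
            ≈⟨ sum-cong-≋ (λ j → K≈shifted (element j)) ⟩
          sum (λ j → sum (λ i → extended (element i * (1# + s * element j))))
            ≈⟨ ∑-comm (λ j i → extended (element i * (1# + s * element j))) ⟩
          sum (λ i → sum (λ j → extended (element i * (1# + s * element j))))
            ≈⟨ sum-cong-≋ (λ i → inner≈0 (element i)) ⟩
          sum {size} (λ _ → 0ℂ)
            ≈⟨ sum-replicate-zero size ⟩
          0ℂ ∎)
          where
          open ℂ≈
          K : ℂ
          K = kloosterman R finite ψ τ a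

          extended : Carrier → ℂ
          extended = extendByZero R finite summand

          extended-cong : ∀ {x y} → x ≈ y → extended x ≈ℂ extended y
          extended-cong = extendByZero-cong summand (λ {u} {v} → summand-cong {u} {v})

          K≈shifted : ∀ y → K ≈ℂ Σᴿ (λ x → extended (x * (1# + s * y)))
          K≈shifted y = reindex (dilation (1+ y)) extended extended-cong

          inner≈0 : ∀ x → Σᴿ (λ y → extended (x * (1# + s * y))) ≈ℂ 0ℂ
          inner≈0 x with isUnit? R finite x
          ... | yes unit = begin
            Σᴿ (λ y → extended (x * (1# + s * y)))
              ≈⟨ sum-cong-≋ (λ j → ℂR.trans
                   (extendByZero-unit summand (λ {u} {v} → summand-cong {u} {v}) (u ∙ 1+ element j) refl)
                   (summand-shift τ-trivial u (element j))) ⟩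
            Σᴿ (λ y → summand u *ℂ value ψ (s * defect u * y))
              ≈⟨ *-distribˡ-sum (summand u) (λ j → value ψ (s * defect u * element j)) ⟨
            summand u *ℂ Σᴿ (λ y → value ψ (s * defect u * y))
              ≈⟨ ℂR.*-congˡ (sum-additive≈0 (s * defect u) (nontrivial u)) ⟩
            summand u *ℂ 0ℂ
              ≈⟨ ℂR.zeroʳ (summand u) ⟩
            0ℂ ∎
            where
            u : Units R
            u = x , unit
          -- As x divides x(1 + sy), a nonunit x makes every term 0.
          ... | no ¬unit = ℂR.trans
            (sum-cong-≋ λ j → extendByZero-nonunit summand (λ {u} {v} → summand-cong {u} {v})
              (¬unit ∘ factor-unit (element j)))
            (sum-replicate-zero size)
            where
            factor-unit : ∀ y → IsUnit R (x * (1# + s * y)) → IsUnit R x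
            factor-unit y (z , z*xw≈1 , xw*z≈1) = w * z ,
              trans (solve 3 (λ x w z → w :* z :* x := z :* (x :* w)) refl x w z) z*xw≈1 ,
              trans (sym (*-assoc x w z)) xw*z≈1
              where
              w : Carrier
              w = 1# + s * y

          -- Stated for any enumeration so that its length can be split; length 0 is excluded
          -- because `0#` has an index.
          n·K≈0⇒K≈0 : ∀ {n} → Inverse (≡.setoid (Fin n)) setoid → sum {n} (λ _ → K) ≈ℂ 0ℂ → K ≈ℂ 0ℂ
          n·K≈0⇒K≈0 {zero}  enum _    with () ← Inverse.from enum 0#
          n·K≈0⇒K≈0 {suc n} _    nK≈0 = ℂ-torsion-free n (ℂR.trans (ℂR.sym (sum-replicate (suc n))) nK≈0)

mainTheorem3 : ∀ {c ℓ} (R : CommutativeRing c ℓ) (finite : IsFinite R) (local : IsLocal R) →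
    IsFrobenius R → ¬ IsField R →
    (ψ : AdditiveCharacter R) → IsPrimitiveAdditive R ψ →
    (τ : MultiplicativeCharacter R) → ¬ IsPrimitiveMultiplicative R local τ →
    let open CommutativeRing R using (Carrier) in
    (∀ (a : Carrier) → ¬ IsUnit R a → kloosterman R finite ψ τ a ≈ℂ 0ℂ)
    × (HasOddCharacteristic R local →
    ∀ (a : Carrier) → ¬ IsSquareOfUnit R a → kloosterman R finite ψ τ a ≈ℂ 0ℂ)
mainTheorem3 R finite local _ ¬field ψ ψ-primitive τ τ-nonprimitive =
  -- Adding au⁻¹ ∈ M to the defect would put the unit u into M.
  (λ a ¬unit → vanishes a λ (u , u⁻¹ , inverses) u-au⁻¹∈M →
    ∈M⇒nonunit R finite local (∈-resp-≈ (trans (+-assoc u _ _) (trans (+-congˡ (-‿inverseˡ _)) (+-identityʳ u)))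
      (+-closed u-au⁻¹∈M (∈-resp-≈ (*-comm u⁻¹ a) (*-closed u⁻¹ (nonunit⇒∈M R finite local ¬unit)))))
      (u⁻¹ , inverses)) ,
  (λ odd a ¬square → vanishes a λ (u , u⁻¹ , u⁻¹u≈1 , uu⁻¹≈1) u-au⁻¹∈M →
    ¬square (∈M⇒square R finite local (odd⇒2-unit R finite local odd) u⁻¹u≈1 uu⁻¹≈1 u-au⁻¹∈M))
  where
  open CommutativeRing R
  open IsLocal local using (M)
  open Ideal M

  -- A single element replaces the ideal I: τ is trivial on 1 + xR.
  TrivialMultiples : Set _
  TrivialMultiples = ∃[ x ] (¬ x ≈ 0#) × x ∈ M ×
    (∀ y u → proj₁ u ≈ 1# + x * y → value τ u ≈ℂ 1ℂ)

  -- Suppose there is no such x. If τ is trivial, every nonzero element is a unit and R is a field;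
  -- if not, the zero ideal is the conductor and τ is primitive. The case split on triviality
  -- accounts for the double negation.
  trivialMultiples : ¬ ¬ TrivialMultiples
  trivialMultiples none = ¬¬-excluded-middle {A = IsTrivial R τ} λ where
    (yes trivial) → ¬field
      ( (λ 1≈0 → 1∉M R finite local (∈-resp-≈ (sym 1≈0) 0∈))
      , λ x x≉0 → decidable-stable (isUnit? R finite x) λ ¬unit →
          none (x , x≉0 , nonunit⇒∈M R finite local ¬unit , λ _ u _ → trivial u))
    (no nontrivial) → τ-nonprimitive (inj₂ (nontrivial
      , (λ x≈0 → ∈-resp-≈ (sym x≈0) 0∈)
      , (λ x x≈0 u u≈1+x → ℂR.trans
          (CharacterProperties.value-cong τ {u} {AbelianGroup.ε (unitGroup R)}
            (trans u≈1+x (trans (+-congˡ x≈0) (+-identityʳ 1#))))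
          (CharacterProperties.value-ε τ))
      , λ J J⊆M τ-trivial {x} x∈J → decidable-stable (_≟_ R finite x 0#) λ x≉0 →
          none (x , x≉0 , J⊆M x∈J , λ y u u≈ →
            τ-trivial (x * y) (Ideal.∈-resp-≈ J (*-comm y x) (Ideal.*-closed J y x∈J)) u u≈)))

  -- Take s = xr in the socle. Then s ∈ M gives s² = 0, sR ⊆ xR keeps τ trivial on 1 + sR, and s
  -- times the defect is nonzero because a defect outside M is a unit. Stability of K ≈ 0 absorbs
  -- the double negation on x.
  vanishes : ∀ a → (∀ u → ¬ defect R finite ψ τ a u ∈ M) → kloosterman R finite ψ τ a ≈ℂ 0ℂ
  vanishes a defect∉M = ≈ℂ0-stable λ K≉0 → trivialMultiples λ (x , x≉0 , x∈M , τ-trivial) →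
    let r , xr≉0 , xrM≈0 = socleMultiple R finite local x x≉0
        xr∈M = ∈-resp-≈ (*-comm r x) (*-closed r x∈M)
    in K≉0 (averaging R finite ψ τ a (xrM≈0 xr∈M)
         (λ y u u≈ → τ-trivial (r * y) u (trans u≈ (+-congˡ (*-assoc x r y))))
         (λ u → primitive⇒nontrivial R finite ψ ψ-primitive
           (unit*≉0 R (decidable-stable (isUnit? R finite _) λ ¬unit →
             defect∉M u (nonunit⇒∈M R finite local ¬unit)) xr≉0)))
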